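{- Let $C\subseteq\mathbb{R}^d$ be a rational-preserving Cantor set, i.e. the attractor of an iterated function system $F=(f_1,\ldots,f_J)$ on $\mathbb{R}^d$ with $f_j(\mathbb{Q}^d)\subseteq\mathbb{Q}^d$ for all $1\leq j\leq J$. Assume that there is $f_j\in F$ whose unique fixed point $\underline{\alpha}_j$ lies in $\mathbb{Q}^d$. Assume further that either (i) all contraction maps $f_j\in F$ are one-to-one, or (ii) any element in $C$ has at most countably many addresses (which is true if $C$ satisfies the strong separation condition). Let $\Phi:\mathbb{N}\to\mathbb{R}_{>0}$ be any function that tends to $0$ (arbitrarily slowly). Then the set of irrational $\underline{\xi}\in C$ for which $$\Vert\underline{\xi}-\underline{p}/q\Vert>\frac{\Phi(Q)}{Q}$$ holds for infinitely many positive integers $Q$ and every $\underline{p}/q\in\mathbb{Q}^d\setminus C$ with $1\leq q\leq Q$, is uncountable and dense in $C$.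
   Context: $\mathbb{R}^d$ carries the supremum norm $\Vert\cdot\Vert$. A contraction is a map $f:\mathbb{R}^d\to\mathbb{R}^d$ for which there is $\tau\in(0,1)$ with $\Vert f(\underline{x})-f(\underline{y})\Vert\leq\tau\Vert\underline{x}-\underline{y}\Vert$ for all $\underline{x},\underline{y}\in\mathbb{R}^d$. An iterated function system is a finite set of contractions; its attractor is the unique nonempty compact set $C$ with $\bigcup_{1\leq j\leq J}f_j(C)=C$, and any such $C$ is called a Cantor set. $C$ satisfies the strong separation condition if the sets $f_j(C)$ are disjoint. An address of $\underline{\xi}\in C$ is a sequence $(\omega_1,\omega_2,\ldots)\in\{1,\ldots,J\}^{\mathbb{N}}$ with $\underline{\xi}=\lim_{i\to\infty}f_{\omega_1}\circ\cdots\circ f_{\omega_i}(\underline{0})$. A vector of $\mathbb{R}^d$ is called irrational if it is not in $\mathbb{Q}^d$, i.e. at least one coordinate is irrational. Rational vectors are written $\underline{p}/q$ with $\underline{p}\in\mathbb{Z}^d$ and common denominator $q\in\mathbb{N}$.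
   Formalization: C is assumed to have two distinct points, since a one-point attractor (J=1, f(x)=x/2, C={0}) refutes the claim; the aside that strong separation implies (ii) is left out, being false for non-injective maps (f_1=0, f_2=x/3+2/3). -}

module Defs where

open import Level using (0ℓ)
open import Data.Fin using (Fin)
open import Data.Integer using (ℤ)
open import Data.List using (List)
open import Data.List.Relation.Unary.Any using (Any)
open import Data.Nat as ℕ using (ℕ; zero; suc; NonZero)
import Data.Nat.Properties as ℕₚ
open import Data.Product using (Σ-syntax; ∃-syntax; _×_; _,_)
open import Data.Rational as ℚ using (ℚ; 0ℚ; 1ℚ; ½)
import Data.Rational.Properties as ℚₚ
open import Data.Rational.Solver using (module +-*-Solver)
open import Data.Sum using (_⊎_; inj₁; inj₂)
open import Data.Vec.Functional using (Vector; foldr; map; zipWith)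
open import Data.Vec.Functional.Relation.Binary.Pointwise using (Pointwise)
open import Function using (id; _∘_)
open import Function.Definitions using (Injective)
open import Relation.Binary using (Rel)
open import Relation.Binary.PropositionalEquality
  using (_≡_; refl; sym; trans; cong; cong₂; subst; _≗_)
open import Relation.Nullary using (¬_)
open import Relation.Unary using (Pred; _∈_; _∉_; _⊆_; ⋃; Satisfiable)

------------------------------------------------------------------------
-- Auxiliary estimates in ℚ

private
  halves : ∀ ε → ½ ℚ.* ε ℚ.+ ½ ℚ.* ε ≡ ε
  halves ε = trans (sym (ℚₚ.*-distribʳ-+ ε ½ ½)) (ℚₚ.*-identityˡ ε)

  ½-pos : ∀ {ε} → 0ℚ ℚ.< ε → 0ℚ ℚ.< ½ ℚ.* ε
  ½-pos {ε} 0<ε = subst (ℚ._< ½ ℚ.* ε) (ℚₚ.*-zeroʳ ½) (ℚₚ.*-monoʳ-<-pos ½ 0<ε)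

  p<q+r : ∀ p q {r} → ℚ.∣ p ℚ.- q ∣ ℚ.< r → p ℚ.< q ℚ.+ r
  p<q+r p q {r} h = begin-strict
    p                      ≡⟨ solve 2 (λ a b → a := b :+ (a :- b)) refl p q ⟩
    q ℚ.+ (p ℚ.- q)        <⟨ ℚₚ.+-monoʳ-< q (ℚₚ.≤-<-trans (x≤∣x∣ (p ℚ.- q)) h) ⟩
    q ℚ.+ r                ∎
    where
    open ℚₚ.≤-Reasoning
    open +-*-Solver
    x≤∣x∣ : ∀ x → x ℚ.≤ ℚ.∣ x ∣
    x≤∣x∣ x with ℚₚ.≤-total 0ℚ x
    ... | inj₁ 0≤x = ℚₚ.≤-reflexive (sym (ℚₚ.0≤p⇒∣p∣≡p 0≤x))
    ... | inj₂ x≤0 = ℚₚ.≤-trans x≤0 (ℚₚ.0≤∣p∣ x)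

  -<⇒∣-∣< : ∀ p q {r} → p ℚ.< q ℚ.+ r → q ℚ.< p ℚ.+ r → ℚ.∣ p ℚ.- q ∣ ℚ.< r
  -<⇒∣-∣< p q {r} p<q+r q<p+r with ℚₚ.∣p∣≡p∨∣p∣≡-p (p ℚ.- q)
  ... | inj₁ e = begin-strict
    ℚ.∣ p ℚ.- q ∣          ≡⟨ e ⟩
    p ℚ.- q                <⟨ ℚₚ.+-monoˡ-< (ℚ.- q) p<q+r ⟩
    q ℚ.+ r ℚ.- q          ≡⟨ solve 2 (λ b c → b :+ c :- b := c) refl q r ⟩
    r                      ∎
    where
    open ℚₚ.≤-Reasoning
    open +-*-Solver
  ... | inj₂ e = begin-strict
    ℚ.∣ p ℚ.- q ∣          ≡⟨ e ⟩
    ℚ.- (p ℚ.- q)          ≡⟨ solve 2 (λ a b → :- (a :- b) := b :- a) refl p q ⟩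
    q ℚ.- p                <⟨ ℚₚ.+-monoˡ-< (ℚ.- p) q<p+r ⟩
    p ℚ.+ r ℚ.- p          ≡⟨ solve 2 (λ a c → a :+ c :- a := c) refl p r ⟩
    r                      ∎
    where
    open ℚₚ.≤-Reasoning
    open +-*-Solver

  ∣-∣-comm : ∀ p q → ℚ.∣ p ℚ.- q ∣ ≡ ℚ.∣ q ℚ.- p ∣
  ∣-∣-comm p q = trans
    (cong ℚ.∣_∣ (solve 2 (λ a b → a :- b := :- (b :- a)) refl p q))
    (ℚₚ.∣-p∣≡∣p∣ (q ℚ.- p))
    where
    open +-*-Solver

  ⊔-< : ∀ {p q r} → p ℚ.< r → q ℚ.< r → p ℚ.⊔ q ℚ.< r
  ⊔-< {p} {q} {r} p<r q<r with ℚₚ.⊔-sel p q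
  ... | inj₁ e = subst (ℚ._< r) (sym e) p<r
  ... | inj₂ e = subst (ℚ._< r) (sym e) q<r

  ⊔<⊔+ : ∀ p q p′ q′ {r} → p ℚ.< p′ ℚ.+ r → q ℚ.< q′ ℚ.+ r →
         p ℚ.⊔ q ℚ.< p′ ℚ.⊔ q′ ℚ.+ r
  ⊔<⊔+ p q p′ q′ {r} h k = ⊔-<
    (ℚₚ.<-≤-trans h (ℚₚ.+-monoˡ-≤ r (ℚₚ.p≤p⊔q p′ q′)))
    (ℚₚ.<-≤-trans k (ℚₚ.+-monoˡ-≤ r (ℚₚ.p≤q⊔p p′ q′)))

  *-bound : ∀ a b c {B δ} .{{_ : ℚ.Positive B}} →
            ℚ.∣ c ∣ ℚ.≤ B → ℚ.∣ a ℚ.- b ∣ ℚ.< δ →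
            ℚ.∣ c ℚ.* (a ℚ.- b) ∣ ℚ.< B ℚ.* δ
  *-bound a b c {B} {δ} c≤B h = begin-strict
    ℚ.∣ c ℚ.* (a ℚ.- b) ∣         ≡⟨ ℚₚ.∣p*q∣≡∣p∣*∣q∣ c (a ℚ.- b) ⟩
    ℚ.∣ c ∣ ℚ.* ℚ.∣ a ℚ.- b ∣     ≤⟨ ℚₚ.*-monoʳ-≤-nonNeg ℚ.∣ a ℚ.- b ∣ {{ℚₚ.∣-∣-nonNeg (a ℚ.- b)}} c≤B ⟩
    B ℚ.* ℚ.∣ a ℚ.- b ∣           <⟨ ℚₚ.*-monoʳ-<-pos B h ⟩
    B ℚ.* δ                       ∎
    where
    open ℚₚ.≤-Reasoning

------------------------------------------------------------------------
-- Real numbers: Cauchy sequences of rationals, taken up to _≈_.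

Cauchy : (ℕ → ℚ) → Set
Cauchy s = ∀ ε → 0ℚ ℚ.< ε → ∃[ N ] ∀ m n → N ℕ.≤ m → N ℕ.≤ n →
           ℚ.∣ s m ℚ.- s n ∣ ℚ.< ε

record ℝ : Set where
  constructor mkℝ
  field
    seq    : ℕ → ℚ
    cauchy : Cauchy seq

open ℝ public

infix  4 _≈_ _<_ _≤_
infixl 6 _+_ _-_ _⊔_
infixl 7 _*_
infix  8 -_

_≈_ : Rel ℝ 0ℓ
x ≈ y = ∀ ε → 0ℚ ℚ.< ε → ∃[ N ] ∀ n → N ℕ.≤ n → ℚ.∣ seq x n ℚ.- seq y n ∣ ℚ.< ε

_<_ : Rel ℝ 0ℓ
x < y = ∃[ ε ] 0ℚ ℚ.< ε × ∃[ N ] ∀ n → N ℕ.≤ n → seq x n ℚ.+ ε ℚ.< seq y n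

_≤_ : Rel ℝ 0ℓ
x ≤ y = ¬ (y < x)

fromℚ : ℚ → ℝ
fromℚ r = mkℝ (λ _ → r) λ ε 0<ε → 0 , λ _ _ _ _ →
  subst (λ t → ℚ.∣ t ∣ ℚ.< ε) (sym (ℚₚ.+-inverseʳ r)) 0<ε

0ℝ 1ℝ : ℝ
0ℝ = fromℚ 0ℚ
1ℝ = fromℚ 1ℚ

private abstract
  +-cauchy : ∀ s t → Cauchy s → Cauchy t → Cauchy (λ n → s n ℚ.+ t n)
  +-cauchy s t cs ct ε 0<ε
    with cs (½ ℚ.* ε) (½-pos 0<ε) | ct (½ ℚ.* ε) (½-pos 0<ε)
  ... | M , hs | N , ht = M ℕ.⊔ N , λ m n M⊔N≤m M⊔N≤n → begin-strict
    ℚ.∣ s m ℚ.+ t m ℚ.- (s n ℚ.+ t n) ∣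
      ≡⟨ cong ℚ.∣_∣ (solve 4 (λ a b c d → a :+ b :- (c :+ d) := (a :- c) :+ (b :- d))
                       refl (s m) (t m) (s n) (t n)) ⟩
    ℚ.∣ (s m ℚ.- s n) ℚ.+ (t m ℚ.- t n) ∣
      ≤⟨ ℚₚ.∣p+q∣≤∣p∣+∣q∣ (s m ℚ.- s n) (t m ℚ.- t n) ⟩
    ℚ.∣ s m ℚ.- s n ∣ ℚ.+ ℚ.∣ t m ℚ.- t n ∣
      <⟨ ℚₚ.+-mono-< (hs m n (ℕₚ.m⊔n≤o⇒m≤o M N M⊔N≤m) (ℕₚ.m⊔n≤o⇒m≤o M N M⊔N≤n))
                     (ht m n (ℕₚ.m⊔n≤o⇒n≤o M N M⊔N≤m) (ℕₚ.m⊔n≤o⇒n≤o M N M⊔N≤n)) ⟩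
    ½ ℚ.* ε ℚ.+ ½ ℚ.* ε
      ≡⟨ halves ε ⟩
    ε ∎
    where
    open ℚₚ.≤-Reasoning
    open +-*-Solver

  neg-cauchy : ∀ s → Cauchy s → Cauchy (λ n → ℚ.- s n)
  neg-cauchy s cs ε 0<ε with cs ε 0<ε
  ... | N , h = N , λ m n N≤m N≤n → subst (ℚ._< ε) (eq (s m) (s n)) (h m n N≤m N≤n)
    where
    open +-*-Solver
    eq : ∀ a b → ℚ.∣ a ℚ.- b ∣ ≡ ℚ.∣ ℚ.- a ℚ.- (ℚ.- b) ∣
    eq a b = trans (∣-∣-comm a b)
      (cong ℚ.∣_∣ (solve 2 (λ a b → b :- a := :- a :- (:- b)) refl a b))

  ⊔-cauchy : ∀ s t → Cauchy s → Cauchy t → Cauchy (λ n → s n ℚ.⊔ t n)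
  ⊔-cauchy s t cs ct ε 0<ε with cs ε 0<ε | ct ε 0<ε
  ... | M , hs | N , ht = M ℕ.⊔ N , λ m n M⊔N≤m M⊔N≤n →
    let hs′ = hs m n (ℕₚ.m⊔n≤o⇒m≤o M N M⊔N≤m) (ℕₚ.m⊔n≤o⇒m≤o M N M⊔N≤n)
        ht′ = ht m n (ℕₚ.m⊔n≤o⇒n≤o M N M⊔N≤m) (ℕₚ.m⊔n≤o⇒n≤o M N M⊔N≤n)
    in -<⇒∣-∣< (s m ℚ.⊔ t m) (s n ℚ.⊔ t n)
         (⊔<⊔+ (s m) (t m) (s n) (t n) (p<q+r (s m) (s n) hs′) (p<q+r (t m) (t n) ht′))
         (⊔<⊔+ (s n) (t n) (s m) (t m)
           (p<q+r (s n) (s m) (subst (ℚ._< ε) (∣-∣-comm (s m) (s n)) hs′))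
           (p<q+r (t n) (t m) (subst (ℚ._< ε) (∣-∣-comm (t m) (t n)) ht′)))

  p<p+1 : ∀ p → p ℚ.< p ℚ.+ 1ℚ
  p<p+1 p = subst (ℚ._< p ℚ.+ 1ℚ) (ℚₚ.+-identityʳ p) (ℚₚ.+-monoʳ-< p (ℚₚ.positive⁻¹ 1ℚ))

  EventuallyBounded : (ℕ → ℚ) → ℚ → Set
  EventuallyBounded s B = ∃[ K ] ∀ n → K ℕ.≤ n → ℚ.∣ s n ∣ ℚ.≤ B

  bounded : ∀ s → Cauchy s → ∃[ B ] 0ℚ ℚ.< B × EventuallyBounded s B
  bounded s cs with cs 1ℚ (ℚₚ.positive⁻¹ 1ℚ)
  ... | N , h = ℚ.∣ s N ∣ ℚ.+ 1ℚ , ℚₚ.≤-<-trans (ℚₚ.0≤∣p∣ (s N)) (p<p+1 ℚ.∣ s N ∣) ,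
                N , λ n N≤n → begin
    ℚ.∣ s n ∣                          ≡⟨ cong ℚ.∣_∣ (solve 2 (λ a b → a := b :+ (a :- b)) refl (s n) (s N)) ⟩
    ℚ.∣ s N ℚ.+ (s n ℚ.- s N) ∣        ≤⟨ ℚₚ.∣p+q∣≤∣p∣+∣q∣ (s N) (s n ℚ.- s N) ⟩
    ℚ.∣ s N ∣ ℚ.+ ℚ.∣ s n ℚ.- s N ∣    ≤⟨ ℚₚ.+-monoʳ-≤ ℚ.∣ s N ∣ (ℚₚ.<⇒≤ (h n N N≤n ℕₚ.≤-refl)) ⟩
    ℚ.∣ s N ∣ ℚ.+ 1ℚ                   ∎
    where
    open ℚₚ.≤-Reasoning
    open +-*-Solver

  scale : ∀ B .{{_ : ℚ.Positive B}} ε → 0ℚ ℚ.< ε → ∃[ δ ] 0ℚ ℚ.< δ × B ℚ.* δ ≡ ε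
  scale B ε 0<ε = 1/B ℚ.* ε
    , subst (ℚ._< 1/B ℚ.* ε) (ℚₚ.*-zeroʳ 1/B) (ℚₚ.*-monoʳ-<-pos 1/B {{ℚₚ.1/pos⇒pos B}} 0<ε)
    , trans (sym (ℚₚ.*-assoc B 1/B ε))
        (trans (cong (ℚ._* ε) (ℚₚ.*-inverseʳ B {{ℚₚ.pos⇒nonZero B}})) (ℚₚ.*-identityˡ ε))
    where
    1/B : ℚ
    1/B = (ℚ.1/ B) {{ℚₚ.pos⇒nonZero B}}

  *-cauchy′ : ∀ s t B .{{_ : ℚ.Positive B}} → EventuallyBounded s B → EventuallyBounded t B →
              Cauchy s → Cauchy t → Cauchy (λ n → s n ℚ.* t n)
  *-cauchy′ s t B (Ks , bs) (Kt , bt) cs ct ε 0<ε with scale B (½ ℚ.* ε) (½-pos 0<ε)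
  ... | δ , 0<δ , Bδ with cs δ 0<δ | ct δ 0<δ
  ... | Ms , hs | Mt , ht = (Ks ℕ.⊔ Kt) ℕ.⊔ (Ms ℕ.⊔ Mt) , λ m n N≤m N≤n →
    let K≤m = ℕₚ.m⊔n≤o⇒m≤o (Ks ℕ.⊔ Kt) (Ms ℕ.⊔ Mt) N≤m
        M≤m = ℕₚ.m⊔n≤o⇒n≤o (Ks ℕ.⊔ Kt) (Ms ℕ.⊔ Mt) N≤m
        K≤n = ℕₚ.m⊔n≤o⇒m≤o (Ks ℕ.⊔ Kt) (Ms ℕ.⊔ Mt) N≤n
        M≤n = ℕₚ.m⊔n≤o⇒n≤o (Ks ℕ.⊔ Kt) (Ms ℕ.⊔ Mt) N≤n
    in begin-strict
    ℚ.∣ s m ℚ.* t m ℚ.- s n ℚ.* t n ∣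
      ≡⟨ cong ℚ.∣_∣ (solve 4 (λ a b c d → a :* b :- c :* d := a :* (b :- d) :+ d :* (a :- c))
                       refl (s m) (t m) (s n) (t n)) ⟩
    ℚ.∣ s m ℚ.* (t m ℚ.- t n) ℚ.+ t n ℚ.* (s m ℚ.- s n) ∣
      ≤⟨ ℚₚ.∣p+q∣≤∣p∣+∣q∣ (s m ℚ.* (t m ℚ.- t n)) (t n ℚ.* (s m ℚ.- s n)) ⟩
    ℚ.∣ s m ℚ.* (t m ℚ.- t n) ∣ ℚ.+ ℚ.∣ t n ℚ.* (s m ℚ.- s n) ∣
      <⟨ ℚₚ.+-mono-<
           (*-bound (t m) (t n) (s m) (bs m (ℕₚ.m⊔n≤o⇒m≤o Ks Kt K≤m))
             (ht m n (ℕₚ.m⊔n≤o⇒n≤o Ms Mt M≤m) (ℕₚ.m⊔n≤o⇒n≤o Ms Mt M≤n)))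
           (*-bound (s m) (s n) (t n) (bt n (ℕₚ.m⊔n≤o⇒n≤o Ks Kt K≤n))
             (hs m n (ℕₚ.m⊔n≤o⇒m≤o Ms Mt M≤m) (ℕₚ.m⊔n≤o⇒m≤o Ms Mt M≤n))) ⟩
    B ℚ.* δ ℚ.+ B ℚ.* δ   ≡⟨ cong₂ ℚ._+_ Bδ Bδ ⟩
    ½ ℚ.* ε ℚ.+ ½ ℚ.* ε   ≡⟨ halves ε ⟩
    ε                     ∎
    where
    open ℚₚ.≤-Reasoning
    open +-*-Solver

  *-cauchy : ∀ s t → Cauchy s → Cauchy t → Cauchy (λ n → s n ℚ.* t n)
  *-cauchy s t cs ct = combine (bounded s cs) (bounded t ct)
    where
    combine : ∃[ B ] 0ℚ ℚ.< B × EventuallyBounded s B →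
              ∃[ B ] 0ℚ ℚ.< B × EventuallyBounded t B →
              Cauchy (λ n → s n ℚ.* t n)
    combine (Bs , 0<Bs , Ks , bs) (Bt , _ , Kt , bt) =
      *-cauchy′ s t (Bs ℚ.⊔ Bt)
        {{ℚ.positive (ℚₚ.<-≤-trans 0<Bs (ℚₚ.p≤p⊔q Bs Bt))}}
        (Ks , λ n K≤n → ℚₚ.≤-trans (bs n K≤n) (ℚₚ.p≤p⊔q Bs Bt))
        (Kt , λ n K≤n → ℚₚ.≤-trans (bt n K≤n) (ℚₚ.p≤q⊔p Bs Bt))
        cs ct

_+_ : ℝ → ℝ → ℝ
x + y = mkℝ (λ n → seq x n ℚ.+ seq y n) (+-cauchy (seq x) (seq y) (cauchy x) (cauchy y))

-_ : ℝ → ℝ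
- x = mkℝ (λ n → ℚ.- seq x n) (neg-cauchy (seq x) (cauchy x))

_-_ : ℝ → ℝ → ℝ
x - y = x + - y

_*_ : ℝ → ℝ → ℝ
x * y = mkℝ (λ n → seq x n ℚ.* seq y n) (*-cauchy (seq x) (seq y) (cauchy x) (cauchy y))

_⊔_ : ℝ → ℝ → ℝ
x ⊔ y = mkℝ (λ n → seq x n ℚ.⊔ seq y n) (⊔-cauchy (seq x) (seq y) (cauchy x) (cauchy y))

∣_∣ : ℝ → ℝ
∣ x ∣ = x ⊔ - x

-- Division by a positive integer; no other quotient is needed.
infixl 7 _÷ℕ_
_÷ℕ_ : ℝ → (n : ℕ) .{{_ : NonZero n}} → ℝ
x ÷ℕ n = x * fromℚ (ℤ.pos 1 ℚ./ n)

------------------------------------------------------------------------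
-- The space ℝᵈ with the supremum norm

ℝ^ : ℕ → Set
ℝ^ d = Vector ℝ d

infix 4 _≈ᵥ_
_≈ᵥ_ : ∀ {d} → Rel (ℝ^ d) 0ℓ
_≈ᵥ_ = Pointwise _≈_

0ᵥ : ∀ {d} → ℝ^ d
0ᵥ _ = 0ℝ

infixl 6 _-ᵥ_
_-ᵥ_ : ∀ {d} → ℝ^ d → ℝ^ d → ℝ^ d
_-ᵥ_ = zipWith _-_

‖_‖ : ∀ {d} → ℝ^ d → ℝ
‖ x ‖ = foldr _⊔_ 0ℝ (map ∣_∣ x)

-- The rational vector p/q; the fraction need not be in lowest terms.
infixl 7 _/ᵥ_
_/ᵥ_ : ∀ {d} → Vector ℤ d → (q : ℕ) .{{_ : NonZero q}} → ℝ^ d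
p /ᵥ q = map (λ pᵢ → fromℚ (pᵢ ℚ./ q)) p

Rational : ∀ {d} → Pred (ℝ^ d) 0ℓ
Rational {d} x = Σ[ p ∈ Vector ℤ d ] Σ[ q ∈ ℕ ] Σ[ q≢0 ∈ NonZero q ]
                 x ≈ᵥ (p /ᵥ q) {{q≢0}}

Irrational : ∀ {d} → Pred (ℝ^ d) 0ℓ
Irrational x = ¬ Rational x

_⟶0 : (ℕ → ℝ) → Set
s ⟶0 = ∀ (ε : ℝ) → 0ℝ < ε → ∃[ N ] ∀ n → N ℕ.≤ n → ∣ s n ∣ < ε

_⟶ᵥ_ : ∀ {d} → (ℕ → ℝ^ d) → ℝ^ d → Set
s ⟶ᵥ x = (λ n → ‖ s n -ᵥ x ‖) ⟶0

Open : ∀ {d} → Pred (Pred (ℝ^ d) 0ℓ) 0ℓ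
Open {d} U = ∀ (x : ℝ^ d) → x ∈ U → Σ[ ε ∈ ℝ ] 0ℝ < ε × (∀ (y : ℝ^ d) → ‖ y -ᵥ x ‖ < ε → y ∈ U)

Compact : ∀ {d} → Pred (ℝ^ d) 0ℓ → Set₁
Compact {d} C = ∀ {I : Set} (U : I → Pred (ℝ^ d) 0ℓ) → (∀ i → Open (U i)) → C ⊆ ⋃ I U →
                Σ[ is ∈ List I ] ∀ {x} → x ∈ C → Any (λ i → x ∈ U i) is

_DenseIn_ : ∀ {d} → Pred (ℝ^ d) 0ℓ → Pred (ℝ^ d) 0ℓ → Set
_DenseIn_ {d} S C = S ⊆ C ×
  (∀ (x : ℝ^ d) → x ∈ C → ∀ (ε : ℝ) → 0ℝ < ε → Σ[ y ∈ ℝ^ d ] y ∈ S × ‖ y -ᵥ x ‖ < ε)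

------------------------------------------------------------------------
-- Cardinality

-- "At most countable" up to an equality _~_.  The enumeration may take values
-- outside P, so finite and empty P are included as soon as A is inhabited.
Countable : ∀ {A : Set} → Rel A 0ℓ → Pred A 0ℓ → Set
Countable {A} _~_ P = Σ[ e ∈ (ℕ → A) ] ∀ a → a ∈ P → ∃[ n ] e n ~ a

Uncountable : ∀ {A : Set} → Rel A 0ℓ → Pred A 0ℓ → Set
Uncountable _~_ P = ¬ Countable _~_ P

InfinitelyMany : Pred ℕ 0ℓ → Set
InfinitelyMany P = ∀ N → ∃[ n ] N ℕ.≤ n × n ∈ P

------------------------------------------------------------------------
-- Iterated function systems

-- A contraction respects _≈ᵥ_, so it is a map on the quotient as well.
Contraction : ∀ {d} → (ℝ^ d → ℝ^ d) → Set
Contraction {d} f = Σ[ τ ∈ ℝ ] 0ℝ < τ × τ < 1ℝ ×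
  (∀ (x y : ℝ^ d) → ‖ f x -ᵥ f y ‖ ≤ τ * ‖ x -ᵥ y ‖)

record IFS (d : ℕ) : Set where
  field
    J           : ℕ
    f           : Fin J → ℝ^ d → ℝ^ d
    contraction : ∀ j → Contraction (f j)

module _ {d : ℕ} (F : IFS d) where
  open IFS F

  Images : Pred (ℝ^ d) 0ℓ → Pred (ℝ^ d) 0ℓ
  Images C = ⋃ (Fin J) λ j x → Σ[ y ∈ ℝ^ d ] y ∈ C × f j y ≈ᵥ x

  -- The inclusion of Images C in C makes C closed under _≈ᵥ_.
  Attractor : Pred (ℝ^ d) 0ℓ → Set₁
  Attractor C = Satisfiable C × Compact C × (Images C ⊆ C × C ⊆ Images C)

  RationalPreserving : Set
  RationalPreserving = ∀ j x → Rational x → Rational (f j x)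

  RationalFixedPoint : Set
  RationalFixedPoint = Σ[ j ∈ Fin J ] Σ[ α ∈ ℝ^ d ] f j α ≈ᵥ α × Rational α

  OneToOne : Set
  OneToOne = ∀ j → Injective _≈ᵥ_ _≈ᵥ_ (f j)

  compose : (ℕ → Fin J) → ℕ → ℝ^ d → ℝ^ d
  compose ω zero    = id
  compose ω (suc i) = compose ω i ∘ f (ω i)

  Address : ℝ^ d → Pred (ℕ → Fin J) 0ℓ
  Address ξ ω = (λ i → compose ω i 0ᵥ) ⟶ᵥ ξ

  CountablyManyAddresses : Pred (ℝ^ d) 0ℓ → Set
  CountablyManyAddresses C = ∀ ξ → ξ ∈ C → Countable _≗_ (Address ξ)

-- Excludes one-point attractors, e.g. J = 1, or maps with a common fixed point.
NonDegenerate : ∀ {d} → Pred (ℝ^ d) 0ℓ → Set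
NonDegenerate {d} C = Σ[ x ∈ ℝ^ d ] Σ[ y ∈ ℝ^ d ] x ∈ C × y ∈ C × ¬ (x ≈ᵥ y)

PoorlyApproximable : ∀ {d} → Pred (ℝ^ d) 0ℓ → (ℕ → ℝ) → Pred (ℝ^ d) 0ℓ
PoorlyApproximable {d} C Φ ξ =
  InfinitelyMany λ Q → Σ[ Q≢0 ∈ NonZero Q ]
    ∀ (p : Vector ℤ d) (q : ℕ) .{{_ : NonZero q}} → q ℕ.≤ Q → (p /ᵥ q) ∉ C →
      (Φ Q ÷ℕ Q) {{Q≢0}} < ‖ ξ -ᵥ p /ᵥ q ‖

-- A point ξ that is extremely close to a rational p/b ∈ C is poorly approximated
-- by the rationals p′/q outside C with q ≤ Q: these have distance at least 1/(bQ)
-- from p/b, which exceeds Φ(Q)/Q by far once Φ(Q) is small compared with 1/b.  If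
-- ξ ≠ p/b for a sequence of such approximations, then ξ is irrational, as for
-- Liouville numbers.  The images of the rational fixed point are dense in C, so
-- each of these conditions contains a dense open subset of C.  Injectivity, or
-- countability of the sets of addresses, makes C perfect, so avoiding a given point
-- contains a dense open set as well, and Baire's theorem in the compact set C gives
-- a suitable ξ in every ball that moreover avoids any given sequence of points.

{-# OPTIONS --safe #-}
module Submission where

open import Level using (0ℓ)
open import Axiom.ExcludedMiddle using (ExcludedMiddle)
open import Data.Empty using (⊥)
open import Data.Fin using (Fin; zero; suc)
import Data.Fin.Properties as Finₚ
open import Data.Integer as ℤ using (ℤ)
import Data.Integer.Properties as ℤₚ
import Data.Integer.Solver as ℤ-Solver
import Data.List.Extrema
open import Data.List.Extrema.Nat using (max; xs≤max)
import Data.List.Relation.Unary.All as All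
open import Data.Nat as ℕ using (ℕ; zero; suc; NonZero)
import Data.Nat.Properties as ℕₚ
open import Data.Product using (Σ-syntax; ∃-syntax; _×_; _,_; proj₁; proj₂)
open import Data.Rational as ℚ using (ℚ; 0ℚ; 1ℚ; ½)
import Data.Rational.Properties as ℚₚ
open import Data.Rational.Solver using (module +-*-Solver)
import Data.Rational.Unnormalised as ℚᵘ
import Data.Rational.Unnormalised.Properties as ℚᵘₚ
open import Data.Sum using (_⊎_; inj₁; inj₂; [_,_]′)
open import Data.Vec.Functional using (Vector)
open import Function using (_∘_; id)
open import Relation.Binary using (DecTotalOrder)
open import Relation.Binary.PropositionalEquality
  using (_≡_; _≢_; refl; sym; trans; cong; cong₂; subst; subst₂; module ≡-Reasoning)
open import Relation.Nullary using (¬_; yes; no)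
open import Relation.Nullary.Decidable using (decidable-stable)
open import Relation.Unary using (Pred; _∈_; _∉_)
open import Defs

open Data.List.Extrema (DecTotalOrder.totalOrder ℚₚ.≤-decTotalOrder)
  using (⊥≤max) renaming (max to maxℚ; xs≤max to xs≤maxℚ)

-- Rational numbers

½+½ : ∀ ε → ½ ℚ.* ε ℚ.+ ½ ℚ.* ε ≡ ε
½+½ ε = trans (sym (ℚₚ.*-distribʳ-+ ε ½ ½)) (ℚₚ.*-identityˡ ε)

*-pos : ∀ {p q} → 0ℚ ℚ.< p → 0ℚ ℚ.< q → 0ℚ ℚ.< p ℚ.* q
*-pos {p} {q} 0<p 0<q =
  ℚₚ.positive⁻¹ (p ℚ.* q) {{ℚₚ.pos*pos⇒pos p {{ℚ.positive 0<p}} q {{ℚ.positive 0<q}}}}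

*-nonNeg : ∀ {p q} → 0ℚ ℚ.≤ p → 0ℚ ℚ.≤ q → 0ℚ ℚ.≤ p ℚ.* q
*-nonNeg {p} {q} 0≤p 0≤q =
  ℚₚ.nonNegative⁻¹ (p ℚ.* q) {{ℚₚ.nonNeg*nonNeg⇒nonNeg p {{ℚ.nonNegative 0≤p}} q {{ℚ.nonNegative 0≤q}}}}

*-monoˡ : ∀ {p q} r → 0ℚ ℚ.≤ r → p ℚ.≤ q → r ℚ.* p ℚ.≤ r ℚ.* q
*-monoˡ r 0≤r p≤q = ℚₚ.*-monoˡ-≤-nonNeg r {{ℚ.nonNegative 0≤r}} p≤q

*-monoʳ : ∀ {p q} r → 0ℚ ℚ.≤ r → p ℚ.≤ q → p ℚ.* r ℚ.≤ q ℚ.* r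
*-monoʳ r 0≤r p≤q = ℚₚ.*-monoʳ-≤-nonNeg r {{ℚ.nonNegative 0≤r}} p≤q

½-pos : ∀ {ε} → 0ℚ ℚ.< ε → 0ℚ ℚ.< ½ ℚ.* ε
½-pos = *-pos (ℚₚ.positive⁻¹ ½)

p≤p+q : ∀ {p q} → 0ℚ ℚ.≤ q → p ℚ.≤ p ℚ.+ q
p≤p+q {p} {q} 0≤q = subst (ℚ._≤ p ℚ.+ q) (ℚₚ.+-identityʳ p) (ℚₚ.+-monoʳ-≤ p 0≤q)

p<p+q : ∀ {p q} → 0ℚ ℚ.< q → p ℚ.< p ℚ.+ q
p<p+q {p} {q} 0<q = subst (ℚ._< p ℚ.+ q) (ℚₚ.+-identityʳ p) (ℚₚ.+-monoʳ-< p 0<q)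

0<q-p : ∀ {p q} → p ℚ.< q → 0ℚ ℚ.< q ℚ.- p
0<q-p {p} {q} p<q = subst (ℚ._< q ℚ.- p) (ℚₚ.+-inverseʳ p) (ℚₚ.+-monoˡ-< (ℚ.- p) p<q)

p+[q-p] : ∀ p q → p ℚ.+ (q ℚ.- p) ≡ q
p+[q-p] = solve 2 (λ p q → p :+ (q :- p) := q) refl
  where open +-*-Solver

p≤∣p∣ : ∀ p → p ℚ.≤ ℚ.∣ p ∣
p≤∣p∣ p with ℚₚ.≤-total 0ℚ p
... | inj₁ 0≤p = ℚₚ.≤-reflexive (sym (ℚₚ.0≤p⇒∣p∣≡p 0≤p))
... | inj₂ p≤0 = ℚₚ.≤-trans p≤0 (ℚₚ.0≤∣p∣ p)

p≤q+∣p-q∣ : ∀ p q → p ℚ.≤ q ℚ.+ ℚ.∣ p ℚ.- q ∣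
p≤q+∣p-q∣ p q = subst (ℚ._≤ q ℚ.+ ℚ.∣ p ℚ.- q ∣) (p+[q-p] q p) (ℚₚ.+-monoʳ-≤ q (p≤∣p∣ (p ℚ.- q)))

∣p-q∣≡∣q-p∣ : ∀ p q → ℚ.∣ p ℚ.- q ∣ ≡ ℚ.∣ q ℚ.- p ∣
∣p-q∣≡∣q-p∣ p q = trans
  (cong ℚ.∣_∣ (solve 2 (λ a b → a :- b := :- (b :- a)) refl p q))
  (ℚₚ.∣-p∣≡∣p∣ (q ℚ.- p))
  where open +-*-Solver

∣p-r∣≤∣p-q∣+∣q-r∣ : ∀ p q r → ℚ.∣ p ℚ.- r ∣ ℚ.≤ ℚ.∣ p ℚ.- q ∣ ℚ.+ ℚ.∣ q ℚ.- r ∣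
∣p-r∣≤∣p-q∣+∣q-r∣ p q r = subst (ℚ._≤ ℚ.∣ p ℚ.- q ∣ ℚ.+ ℚ.∣ q ℚ.- r ∣)
  (cong ℚ.∣_∣ (solve 3 (λ p q r → (p :- q) :+ (q :- r) := p :- r) refl p q r))
  (ℚₚ.∣p+q∣≤∣p∣+∣q∣ (p ℚ.- q) (q ℚ.- r))
  where open +-*-Solver

p⊔-p≡∣p∣ : ∀ p → p ℚ.⊔ (ℚ.- p) ≡ ℚ.∣ p ∣
p⊔-p≡∣p∣ p with ℚₚ.≤-total 0ℚ p
... | inj₁ 0≤p = trans (ℚₚ.p≥q⇒p⊔q≡p (ℚₚ.≤-trans (ℚₚ.neg-antimono-≤ 0≤p) 0≤p)) (sym (ℚₚ.0≤p⇒∣p∣≡p 0≤p))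
... | inj₂ p≤0 = trans (ℚₚ.p≤q⇒p⊔q≡q (ℚₚ.≤-trans p≤0 (ℚₚ.neg-antimono-≤ p≤0)))
  (trans (sym (ℚₚ.0≤p⇒∣p∣≡p (ℚₚ.neg-antimono-≤ p≤0))) (ℚₚ.∣-p∣≡∣p∣ p))

-- Integers and denominators among the rational numbers

abstract

  -- Kept abstract because `ℚ._/_` reduces to lowest terms, a computation that should not unfold in
  -- later goals.
  ι : ℤ → ℚ
  ι i = i ℚ./ 1

ιₙ : ℕ → ℚ
ιₙ n = ι (ℤ.+ n)

abstract

  -- Unnormalised fractions are equal by cross-multiplication, so identities about `ι` can be
  -- transported there and become integer algebra.
  ιᵘ : ∀ i n .{{_ : NonZero n}} → ℚ.toℚᵘ (i ℚ./ n) ℚᵘ.≃ i ℚᵘ./ n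
  ιᵘ i (suc n) = ℚₚ.toℚᵘ-fromℚᵘ (ℚᵘ.mkℚᵘ i n)

  /-*-ι : ∀ i n .{{_ : NonZero n}} → (i ℚ./ n) ℚ.* ιₙ n ≡ ι i
  /-*-ι i n@(suc _) = ℚₚ.toℚᵘ-injective (begin
    ℚ.toℚᵘ ((i ℚ./ n) ℚ.* ιₙ n)             ≈⟨ ℚₚ.toℚᵘ-homo-* (i ℚ./ n) (ιₙ n) ⟩
    ℚ.toℚᵘ (i ℚ./ n) ℚᵘ.* ℚ.toℚᵘ (ιₙ n)     ≈⟨ ℚᵘₚ.*-cong (ιᵘ i n) (ιᵘ (ℤ.+ n) 1) ⟩
    (i ℚᵘ./ n) ℚᵘ.* (ℤ.+ n ℚᵘ./ 1)          ≈⟨ ℚᵘ.*≡* (trans (ℤₚ.*-identityʳ _) (cong (λ k → i ℤ.* ℤ.+ k) (sym (ℕₚ.*-identityʳ n)))) ⟩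
    i ℚᵘ./ 1                                ≈⟨ ιᵘ i 1 ⟨
    ℚ.toℚᵘ (ι i)                            ∎)
    where open ℚᵘₚ.≃-Reasoning

  ι-+ : ∀ i j → ι (i ℤ.+ j) ≡ ι i ℚ.+ ι j
  ι-+ i j = ℚₚ.toℚᵘ-injective (begin
    ℚ.toℚᵘ (ι (i ℤ.+ j))              ≈⟨ ιᵘ (i ℤ.+ j) 1 ⟩
    (i ℤ.+ j) ℚᵘ./ 1                  ≈⟨ ℚᵘ.*≡* (solve 2 (λ i j → (i :+ j) :* con (ℤ.+ 1) := (i :* con (ℤ.+ 1) :+ j :* con (ℤ.+ 1)) :* con (ℤ.+ 1)) refl i j) ⟩
    (i ℚᵘ./ 1) ℚᵘ.+ (j ℚᵘ./ 1)        ≈⟨ ℚᵘₚ.+-cong (ιᵘ i 1) (ιᵘ j 1) ⟨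
    ℚ.toℚᵘ (ι i) ℚᵘ.+ ℚ.toℚᵘ (ι j)    ≈⟨ ℚₚ.toℚᵘ-homo-+ (ι i) (ι j) ⟨
    ℚ.toℚᵘ (ι i ℚ.+ ι j)              ∎)
    where
    open ℚᵘₚ.≃-Reasoning
    open ℤ-Solver.+-*-Solver

  ι-zero : ιₙ 0 ≡ 0ℚ
  ι-zero = refl

  ι-one : ι (ℤ.+ 1) ≡ 1ℚ
  ι-one = refl

  ι-suc : ∀ n → ιₙ (suc n) ≡ 1ℚ ℚ.+ ιₙ n
  ι-suc n = ι-+ (ℤ.+ 1) (ℤ.+ n)

  ι-* : ∀ i j → ι (i ℤ.* j) ≡ ι i ℚ.* ι j
  ι-* i j = ℚₚ.toℚᵘ-injective (begin
    ℚ.toℚᵘ (ι (i ℤ.* j))              ≈⟨ ιᵘ (i ℤ.* j) 1 ⟩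
    (i ℚᵘ./ 1) ℚᵘ.* (j ℚᵘ./ 1)        ≈⟨ ℚᵘₚ.*-cong (ιᵘ i 1) (ιᵘ j 1) ⟨
    ℚ.toℚᵘ (ι i) ℚᵘ.* ℚ.toℚᵘ (ι j)    ≈⟨ ℚₚ.toℚᵘ-homo-* (ι i) (ι j) ⟨
    ℚ.toℚᵘ (ι i ℚ.* ι j)              ∎)
    where open ℚᵘₚ.≃-Reasoning

  ι-neg : ∀ i → ι (ℤ.- i) ≡ ℚ.- ι i
  ι-neg i = begin
    ι (ℤ.- i)                            ≡⟨ solve 2 (λ a b → a := (b :+ a) :- b) refl (ι (ℤ.- i)) (ι i) ⟩
    ι i ℚ.+ ι (ℤ.- i) ℚ.- ι i            ≡⟨ cong (ℚ._- ι i) (trans (sym (ι-+ i (ℤ.- i))) (cong ι (ℤₚ.+-inverseʳ i))) ⟩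
    0ℚ ℚ.- ι i                           ≡⟨ ℚₚ.+-identityˡ (ℚ.- ι i) ⟩
    ℚ.- ι i                              ∎
    where
    open ≡-Reasoning
    open +-*-Solver

  ιₙ-mono-≤ : ∀ m n → m ℕ.≤ n → ιₙ m ℚ.≤ ιₙ n
  ιₙ-mono-≤ m n m≤n = ℚₚ.toℚᵘ-cancel-≤
    (ℚᵘₚ.≤-respˡ-≃ (ℚᵘₚ.≃-sym (ιᵘ (ℤ.+ m) 1)) (ℚᵘₚ.≤-respʳ-≃ (ℚᵘₚ.≃-sym (ιᵘ (ℤ.+ n) 1))
      (ℚᵘ.*≤* (ℤₚ.*-monoʳ-≤-nonNeg (ℤ.+ 1) (ℤ.+≤+ m≤n)))))

  ι-nonNeg : ∀ n → 0ℚ ℚ.≤ ιₙ n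
  ι-nonNeg n = ιₙ-mono-≤ 0 n ℕ.z≤n

  ∣ι∣ : ∀ i → ℚ.∣ ι i ∣ ≡ ιₙ ℤ.∣ i ∣
  ∣ι∣ (ℤ.+ n) = ℚₚ.0≤p⇒∣p∣≡p (ι-nonNeg n)
  ∣ι∣ ℤ.-[1+ n ] = trans (cong ℚ.∣_∣ (ι-neg (ℤ.+ suc n))) (trans (ℚₚ.∣-p∣≡∣p∣ (ι (ℤ.+ suc n))) (∣ι∣ (ℤ.+ suc n)))

  1≤ι : ∀ n .{{_ : NonZero n}} → 1ℚ ℚ.≤ ιₙ n
  1≤ι (suc n) = ιₙ-mono-≤ 1 (suc n) (ℕ.s≤s ℕ.z≤n)

  ι-pos : ∀ n .{{_ : NonZero n}} → 0ℚ ℚ.< ιₙ n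
  ι-pos n = ℚₚ.<-≤-trans (ℚₚ.positive⁻¹ 1ℚ) (1≤ι n)

  1≤∣ι∣ : ∀ i → i ≢ ℤ.0ℤ → 1ℚ ℚ.≤ ℚ.∣ ι i ∣
  1≤∣ι∣ i i≢0 = subst (1ℚ ℚ.≤_) (sym (∣ι∣ i)) (1≤ι ℤ.∣ i ∣ {{ℕ.≢-nonZero (i≢0 ∘ ℤₚ.∣i∣≡0⇒i≡0)}})

  -- The numerator of p/b − p′/q over the denominator bq is a nonzero integer.
  fractions-apart : ∀ p b p′ q .{{_ : NonZero b}} .{{_ : NonZero q}} →
                    p ℚ./ b ≢ p′ ℚ./ q →
                    1ℚ ℚ.≤ ℚ.∣ p ℚ./ b ℚ.- p′ ℚ./ q ∣ ℚ.* (ιₙ b ℚ.* ιₙ q)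
  fractions-apart p b p′ q x≢y = subst (1ℚ ℚ.≤_) ∣m∣≡ (1≤∣ι∣ m m≢0)
    where
    open ≡-Reasoning
    open +-*-Solver
    x y B Q : ℚ
    x = p ℚ./ b
    y = p′ ℚ./ q
    B = ιₙ b
    Q = ιₙ q
    m : ℤ
    m = p ℤ.* ℤ.+ q ℤ.- p′ ℤ.* ℤ.+ b
    ιm≡ : ι m ≡ (x ℚ.- y) ℚ.* (B ℚ.* Q)
    ιm≡ = begin
      ι m                                      ≡⟨ trans (ι-+ (p ℤ.* ℤ.+ q) (ℤ.- (p′ ℤ.* ℤ.+ b))) (cong (ι (p ℤ.* ℤ.+ q) ℚ.+_) (ι-neg (p′ ℤ.* ℤ.+ b))) ⟩
      ι (p ℤ.* ℤ.+ q) ℚ.- ι (p′ ℤ.* ℤ.+ b) ≡⟨ cong₂ ℚ._-_ (ι-* p (ℤ.+ q)) (ι-* p′ (ℤ.+ b)) ⟩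
      ι p ℚ.* Q ℚ.- ι p′ ℚ.* B                 ≡⟨ cong₂ (λ u v → u ℚ.* Q ℚ.- v ℚ.* B) (/-*-ι p b) (/-*-ι p′ q) ⟨
      x ℚ.* B ℚ.* Q ℚ.- y ℚ.* Q ℚ.* B          ≡⟨ solve 4 (λ x y B Q → x :* B :* Q :- y :* Q :* B := (x :- y) :* (B :* Q)) refl x y B Q ⟩
      (x ℚ.- y) ℚ.* (B ℚ.* Q)                  ∎
    BQ≥0 : 0ℚ ℚ.≤ B ℚ.* Q
    BQ≥0 = *-nonNeg (ι-nonNeg b) (ι-nonNeg q)
    ∣m∣≡ : ℚ.∣ ι m ∣ ≡ ℚ.∣ x ℚ.- y ∣ ℚ.* (B ℚ.* Q)
    ∣m∣≡ = trans (cong ℚ.∣_∣ ιm≡) (trans (ℚₚ.∣p*q∣≡∣p∣*∣q∣ (x ℚ.- y) (B ℚ.* Q))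
      (cong (ℚ.∣ x ℚ.- y ∣ ℚ.*_) (ℚₚ.0≤p⇒∣p∣≡p BQ≥0)))
    m≢0 : m ≢ ℤ.0ℤ
    m≢0 m≡0 = x≢y (begin
      x                          ≡⟨ p+[q-p] y x ⟨
      y ℚ.+ (x ℚ.- y)            ≡⟨ cong (y ℚ.+_) (ℚₚ.≤-antisym
                                      (cancel (ℚₚ.≤-reflexive x-y≡0))
                                      (cancel (ℚₚ.≤-reflexive (sym x-y≡0)))) ⟩
      y ℚ.+ 0ℚ                   ≡⟨ ℚₚ.+-identityʳ y ⟩
      y                          ∎)
      where
      cancel : ∀ {u v} → u ℚ.* (B ℚ.* Q) ℚ.≤ v ℚ.* (B ℚ.* Q) → u ℚ.≤ v
      cancel = ℚₚ.*-cancelʳ-≤-pos (B ℚ.* Q) {{ℚ.positive (*-pos (ι-pos b) (ι-pos q))}}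
      x-y≡0 : (x ℚ.- y) ℚ.* (B ℚ.* Q) ≡ 0ℚ ℚ.* (B ℚ.* Q)
      x-y≡0 = trans (sym ιm≡) (trans (cong ι m≡0) (sym (ℚₚ.*-zeroˡ (B ℚ.* Q))))

  archimedean : ∀ a b → 0ℚ ℚ.< b → ∃[ n ] a ℚ.≤ ιₙ n ℚ.* b
  archimedean a b 0<b = n , subst (ℚ._≤ ιₙ n ℚ.* b) cb≡a (*-monoʳ b (ℚₚ.<⇒≤ 0<b) c≤n)
    where
    b≢0 : ℚ.NonZero b
    b≢0 = ℚ.>-nonZero 0<b
    c : ℚ
    c = a ℚ.* (ℚ.1/ b) {{b≢0}}
    cb≡a : c ℚ.* b ≡ a
    cb≡a = trans (ℚₚ.*-assoc a _ b) (trans (cong (a ℚ.*_) (ℚₚ.*-inverseˡ b {{b≢0}})) (ℚₚ.*-identityʳ a))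
    -- The denominator of `c` is at least 1, so ∣c∣ is bounded by the absolute value of its
    -- numerator.
    n : ℕ
    n = ℤ.∣ ℚ.↥ c ∣
    D : ℚ
    D = ι (ℚ.↧ c)
    c≤n : c ℚ.≤ ιₙ n
    c≤n = begin
      c                          ≤⟨ p≤∣p∣ c ⟩
      ℚ.∣ c ∣                    ≡⟨ ℚₚ.*-identityʳ ℚ.∣ c ∣ ⟨
      ℚ.∣ c ∣ ℚ.* 1ℚ             ≤⟨ *-monoˡ ℚ.∣ c ∣ (ℚₚ.0≤∣p∣ c) (1≤ι (ℚ.↧ₙ c)) ⟩
      ℚ.∣ c ∣ ℚ.* D              ≡⟨ cong (ℚ.∣ c ∣ ℚ.*_) (∣ι∣ (ℚ.↧ c)) ⟨
      ℚ.∣ c ∣ ℚ.* ℚ.∣ D ∣        ≡⟨ ℚₚ.∣p*q∣≡∣p∣*∣q∣ c D ⟨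
      ℚ.∣ c ℚ.* D ∣              ≡⟨ cong ℚ.∣_∣ (trans (cong (ℚ._* D) (sym (ℚₚ.↥p/↧p≡p c))) (/-*-ι (ℚ.↥ c) (ℚ.↧ₙ c))) ⟩
      ℚ.∣ ι (ℚ.↥ c) ∣            ≡⟨ ∣ι∣ (ℚ.↥ c) ⟩
      ιₙ n                       ∎
      where open ℚₚ.≤-Reasoning

inverse : ∀ n .{{_ : NonZero n}} → (ℤ.+ 1 ℚ./ n) ℚ.* ιₙ n ≡ 1ℚ
inverse n = trans (/-*-ι (ℤ.+ 1) n) ι-one

0<1/ : ∀ n .{{_ : NonZero n}} → 0ℚ ℚ.< ℤ.+ 1 ℚ./ n
0<1/ n = ℚₚ.positive⁻¹ (ℤ.+ 1 ℚ./ n) {{ℚₚ.normalize-pos 1 n}}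

-- Real numbers and the supremum norm

Eventually : (ℕ → Set) → Set
Eventually P = ∃[ N ] ∀ n → N ℕ.≤ n → P n

always : {P : ℕ → Set} → (∀ n → P n) → Eventually P
always p = 0 , λ n _ → p n

map∞ : {P Q : ℕ → Set} → (∀ n → P n → Q n) → Eventually P → Eventually Q
map∞ f (N , p) = N , λ n N≤n → f n (p n N≤n)

zip∞ : {P Q R : ℕ → Set} → (∀ n → P n → Q n → R n) → Eventually P → Eventually Q → Eventually R
zip∞ f (M , p) (N , q) = M ℕ.⊔ N , λ n M⊔N≤n →
  f n (p n (ℕₚ.m⊔n≤o⇒m≤o M N M⊔N≤n)) (q n (ℕₚ.m⊔n≤o⇒n≤o M N M⊔N≤n))

all∞ : ∀ {d} {P : Fin d → ℕ → Set} → (∀ i → Eventually (P i)) → Eventually (λ n → ∀ i → P i n)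
all∞ {zero}  p = 0 , λ _ _ ()
all∞ {suc d} p = zip∞ (λ { n p₀ ps zero → p₀ ; n p₀ ps (suc i) → ps i }) (p zero) (all∞ (p ∘ suc))

infix 4 _≲_

-- A positive form of the order, unlike the negation `_≤_`, so that estimates can be made term by
-- term. The slack `ε` is there because a sequence may approach its limit from above.
_≲_ : ℝ → ℚ → Set
x ≲ r = ∀ ε → 0ℚ ℚ.< ε → Eventually λ n → seq x n ℚ.≤ r ℚ.+ ε

pointwise⇒≲ : ∀ {x r} → (∀ n → seq x n ℚ.≤ r) → x ≲ r
pointwise⇒≲ h ε 0<ε = always λ n → ℚₚ.≤-trans (h n) (p≤p+q (ℚₚ.<⇒≤ 0<ε))

<fromℚ⇒≲ : ∀ {x r} → x < fromℚ r → x ≲ r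
<fromℚ⇒≲ {x} {r} (δ , 0<δ , h) ε 0<ε = map∞ (λ n p → begin
    seq x n              ≤⟨ p≤p+q (ℚₚ.<⇒≤ 0<δ) ⟩
    seq x n ℚ.+ δ        <⟨ p ⟩
    r                    <⟨ p<p+q 0<ε ⟩
    r ℚ.+ ε              ∎) h
  where open ℚₚ.≤-Reasoning

below-positive : ∀ {x} → 0ℝ < x → ∃[ r ] 0ℚ ℚ.< r × (∀ y → y ≲ r → y < x)
below-positive {x} (e , 0<e , h) = q , 0<q , λ y y≲q → ½ ℚ.* e , ½-pos 0<e ,
    zip∞ (λ n hn yn → begin-strict
      seq y n ℚ.+ ½ ℚ.* e         ≤⟨ ℚₚ.+-monoˡ-≤ (½ ℚ.* e) yn ⟩
      q ℚ.+ q ℚ.+ ½ ℚ.* e         ≡⟨ trans (cong (ℚ._+ ½ ℚ.* e) (½+½ (½ ℚ.* e))) (½+½ e) ⟩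
      e                           ≡⟨ ℚₚ.+-identityˡ e ⟨
      0ℚ ℚ.+ e                    <⟨ hn ⟩
      seq x n                     ∎) h (y≲q q 0<q)
  where
  open ℚₚ.≤-Reasoning
  -- A quarter of `e`: the bound `q`, its slack `q` and the gap e/2 required by `_<_` add up to `e`.
  q : ℚ
  q = ½ ℚ.* (½ ℚ.* e)
  0<q : 0ℚ ℚ.< q
  0<q = ½-pos (½-pos 0<e)

≲-bounded : ∀ x → ∃[ r ] x ≲ r
≲-bounded x with cauchy x 1ℚ (ℚₚ.positive⁻¹ 1ℚ)
... | N , h = seq x N ℚ.+ 1ℚ , λ ε 0<ε → N , λ n N≤n → begin
    seq x n                                 ≤⟨ p≤q+∣p-q∣ (seq x n) (seq x N) ⟩
    seq x N ℚ.+ ℚ.∣ seq x n ℚ.- seq x N ∣   ≤⟨ ℚₚ.+-monoʳ-≤ (seq x N) (ℚₚ.<⇒≤ (h n N N≤n ℕₚ.≤-refl)) ⟩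
    seq x N ℚ.+ 1ℚ                          ≤⟨ p≤p+q (ℚₚ.<⇒≤ 0<ε) ⟩
    seq x N ℚ.+ 1ℚ ℚ.+ ε                    ∎
  where open ℚₚ.≤-Reasoning

-- If the bound failed at one index beyond both Cauchy moduli for ε/4, the gap ε there could shrink
-- by at most ε/2 at later indices, which would prove y < x. The order of ℚ is decidable, so
-- refuting the failure gives the bound.
≤⇒eventually : ∀ {x y} → x ≤ y → ∀ ε → 0ℚ ℚ.< ε → Eventually λ n → seq x n ℚ.≤ seq y n ℚ.+ ε
≤⇒eventually {x} {y} x≤y ε 0<ε
  with cauchy x η (½-pos (½-pos 0<ε)) | cauchy y η (½-pos (½-pos 0<ε))
  where
  η : ℚ
  η = ½ ℚ.* (½ ℚ.* ε)
... | M , hx | N , hy = M ℕ.⊔ N , λ n le → bound n (ℕₚ.m⊔n≤o⇒m≤o M N le) (ℕₚ.m⊔n≤o⇒n≤o M N le)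
  where
  open ℚₚ.≤-Reasoning
  open +-*-Solver
  η : ℚ
  η = ½ ℚ.* (½ ℚ.* ε)
  4η : ε ≡ ½ ℚ.* ε ℚ.+ (η ℚ.+ η)
  4η = sym (trans (cong (½ ℚ.* ε ℚ.+_) (½+½ (½ ℚ.* ε))) (½+½ ε))
  bound : ∀ n → M ℕ.≤ n → N ℕ.≤ n → seq x n ℚ.≤ seq y n ℚ.+ ε
  bound n M≤n N≤n = ℚₚ.≮⇒≥ λ gap → x≤y (½ ℚ.* ε , ½-pos 0<ε , M ℕ.⊔ N , λ m le → begin-strict
    seq y m ℚ.+ ½ ℚ.* ε
      ≤⟨ ℚₚ.+-monoˡ-≤ (½ ℚ.* ε) (p≤q+∣p-q∣ (seq y m) (seq y n)) ⟩
    seq y n ℚ.+ ℚ.∣ seq y m ℚ.- seq y n ∣ ℚ.+ ½ ℚ.* ε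
      ≤⟨ ℚₚ.+-monoˡ-≤ (½ ℚ.* ε) (ℚₚ.+-monoʳ-≤ (seq y n) (ℚₚ.<⇒≤ (hy m n (ℕₚ.m⊔n≤o⇒n≤o M N le) N≤n))) ⟩
    seq y n ℚ.+ η ℚ.+ ½ ℚ.* ε
      ≡⟨ solve 3 (λ y η h → y :+ η :+ h := y :+ (h :+ (η :+ η)) :- η) refl (seq y n) η (½ ℚ.* ε) ⟩
    seq y n ℚ.+ (½ ℚ.* ε ℚ.+ (η ℚ.+ η)) ℚ.- η
      ≡⟨ cong (λ z → seq y n ℚ.+ z ℚ.- η) (sym 4η) ⟩
    seq y n ℚ.+ ε ℚ.- η
      <⟨ ℚₚ.+-monoˡ-< (ℚ.- η) gap ⟩
    seq x n ℚ.- η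
      ≤⟨ ℚₚ.+-monoˡ-≤ (ℚ.- η) (p≤q+∣p-q∣ (seq x n) (seq x m)) ⟩
    seq x m ℚ.+ ℚ.∣ seq x n ℚ.- seq x m ∣ ℚ.- η
      ≤⟨ ℚₚ.+-monoˡ-≤ (ℚ.- η) (ℚₚ.+-monoʳ-≤ (seq x m) (ℚₚ.<⇒≤ (hx n m M≤n (ℕₚ.m⊔n≤o⇒m≤o M N le)))) ⟩
    seq x m ℚ.+ η ℚ.- η
      ≡⟨ solve 2 (λ x η → x :+ η :- η := x) refl (seq x m) η ⟩
    seq x m ∎)

∣coordinate∣≤norm : ∀ {d} (v : ℝ^ d) i n → ℚ.∣ seq (v i) n ∣ ℚ.≤ seq ‖ v ‖ n
∣coordinate∣≤norm v zero    n = subst (ℚ._≤ seq ‖ v ‖ n) (p⊔-p≡∣p∣ (seq (v zero) n)) (ℚₚ.p≤p⊔q _ _)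
∣coordinate∣≤norm v (suc i) n = ℚₚ.≤-trans (∣coordinate∣≤norm (v ∘ suc) i n) (ℚₚ.p≤q⊔p (seq ∣ v zero ∣ n) _)

norm≤ : ∀ {d} (v : ℝ^ d) n {B} → 0ℚ ℚ.≤ B → (∀ i → ℚ.∣ seq (v i) n ∣ ℚ.≤ B) → seq ‖ v ‖ n ℚ.≤ B
norm≤ {zero}  v n 0≤B h = 0≤B
norm≤ {suc d} v n 0≤B h = ℚₚ.⊔-lub (subst (ℚ._≤ _) (sym (p⊔-p≡∣p∣ (seq (v zero) n))) (h zero)) (norm≤ (v ∘ suc) n 0≤B (h ∘ suc))

0≤norm : ∀ {d} (v : ℝ^ d) n → 0ℚ ℚ.≤ seq ‖ v ‖ n
0≤norm {zero}  v n = ℚₚ.≤-refl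
0≤norm {suc d} v n = ℚₚ.≤-trans (0≤norm (v ∘ suc) n) (ℚₚ.p≤q⊔p (seq ∣ v zero ∣ n) _)

-- Points within a rational distance

module _ {d : ℕ} where

  infix 4 _~[_]_

  -- A record and not a synonym, so that the points and the radius can be inferred from the type.
  record _~[_]_ (x : ℝ^ d) (r : ℚ) (y : ℝ^ d) : Set where
    constructor within
    field
      distance≲ : ‖ x -ᵥ y ‖ ≲ r

  open _~[_]_ public

  dist : ℝ^ d → ℝ^ d → ℕ → ℚ
  dist x y n = seq ‖ x -ᵥ y ‖ n

  dist-triangle : ∀ x y z n → dist x z n ℚ.≤ dist x y n ℚ.+ dist y z n
  dist-triangle x y z n = norm≤ (x -ᵥ z) n
    (ℚₚ.≤-trans (0≤norm (x -ᵥ y) n) (p≤p+q (0≤norm (y -ᵥ z) n)))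
    λ i → ℚₚ.≤-trans (∣p-r∣≤∣p-q∣+∣q-r∣ (seq (x i) n) (seq (y i) n) (seq (z i) n))
      (ℚₚ.+-mono-≤ (∣coordinate∣≤norm (x -ᵥ y) i n) (∣coordinate∣≤norm (y -ᵥ z) i n))

  ~-trans : ∀ {x y z r s} → x ~[ r ] y → y ~[ s ] z → x ~[ r ℚ.+ s ] z
  ~-trans {x} {y} {z} {r} {s} xy yz = within λ ε 0<ε → zip∞ (λ n p q → begin
      dist x z n                              ≤⟨ dist-triangle x y z n ⟩
      dist x y n ℚ.+ dist y z n               ≤⟨ ℚₚ.+-mono-≤ p q ⟩
      (r ℚ.+ ½ ℚ.* ε) ℚ.+ (s ℚ.+ ½ ℚ.* ε)     ≡⟨ solve 3 (λ r s h → (r :+ h) :+ (s :+ h) := (r :+ s) :+ (h :+ h)) refl r s (½ ℚ.* ε) ⟩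
      (r ℚ.+ s) ℚ.+ (½ ℚ.* ε ℚ.+ ½ ℚ.* ε)     ≡⟨ cong (r ℚ.+ s ℚ.+_) (½+½ ε) ⟩
      (r ℚ.+ s) ℚ.+ ε                         ∎)
      (distance≲ xy (½ ℚ.* ε) (½-pos 0<ε)) (distance≲ yz (½ ℚ.* ε) (½-pos 0<ε))
    where
    open ℚₚ.≤-Reasoning
    open +-*-Solver

  ~-sym : ∀ {x y r} → x ~[ r ] y → y ~[ r ] x
  ~-sym {x} {y} xy = within λ ε 0<ε → map∞ (λ n → ℚₚ.≤-trans (norm≤ (y -ᵥ x) n (0≤norm (x -ᵥ y) n)
    λ i → subst (ℚ._≤ dist x y n) (∣p-q∣≡∣q-p∣ (seq (x i) n) (seq (y i) n)) (∣coordinate∣≤norm (x -ᵥ y) i n)))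
    (distance≲ xy ε 0<ε)

  ~-mono : ∀ {x y r s} → r ℚ.≤ s → x ~[ r ] y → x ~[ s ] y
  ~-mono {x} {y} {r} {s} r≤s xy = within λ ε 0<ε →
    map∞ (λ n p → ℚₚ.≤-trans p (ℚₚ.+-monoˡ-≤ ε r≤s)) (distance≲ xy ε 0<ε)

  ~-limit : ∀ {x y r} → (∀ ε → 0ℚ ℚ.< ε → x ~[ r ℚ.+ ε ] y) → x ~[ r ] y
  ~-limit {x} {y} {r} h = within λ ε 0<ε →
    map∞ (λ n → subst (dist x y n ℚ.≤_) (eq ε)) (distance≲ (h (½ ℚ.* ε) (½-pos 0<ε)) (½ ℚ.* ε) (½-pos 0<ε))
    where
    eq : ∀ ε → r ℚ.+ ½ ℚ.* ε ℚ.+ ½ ℚ.* ε ≡ r ℚ.+ ε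
    eq ε = trans (ℚₚ.+-assoc r _ _) (cong (r ℚ.+_) (½+½ ε))

  <⇒~ : ∀ {x y r} → ‖ x -ᵥ y ‖ < fromℚ r → x ~[ r ] y
  <⇒~ {x} {y} {r} x-y<r = within (<fromℚ⇒≲ {‖ x -ᵥ y ‖} {r} x-y<r)

  ~-bounded : ∀ x y → ∃[ r ] x ~[ r ] y
  ~-bounded x y = let r , b = ≲-bounded ‖ x -ᵥ y ‖ in r , within b

  ≈⇒~ : ∀ {x y r} → 0ℚ ℚ.≤ r → x ≈ᵥ y → x ~[ r ] y
  ≈⇒~ {x} {y} {r} 0≤r x≈y = within λ ε 0<ε → let
      r≤r+ε = p≤p+q (ℚₚ.<⇒≤ 0<ε)
      ε≤r+ε = subst (ε ℚ.≤_) (ℚₚ.+-comm ε r) (p≤p+q 0≤r)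
    in map∞
      (λ n h → norm≤ (x -ᵥ y) n (ℚₚ.≤-trans 0≤r r≤r+ε) λ i → ℚₚ.≤-trans (ℚₚ.<⇒≤ (h i)) ε≤r+ε)
      (all∞ λ i → x≈y i ε 0<ε)

  ~⇒≈ : ∀ {x y} → (∀ ε → 0ℚ ℚ.< ε → x ~[ ε ] y) → x ≈ᵥ y
  ~⇒≈ {x} {y} h i ε 0<ε = map∞ (λ n p → begin-strict
      ℚ.∣ seq (x i) n ℚ.- seq (y i) n ∣   ≤⟨ ∣coordinate∣≤norm (x -ᵥ y) i n ⟩
      dist x y n                          ≤⟨ p ⟩
      η ℚ.+ η                             ≡⟨ ½+½ (½ ℚ.* ε) ⟩
      ½ ℚ.* ε                             <⟨ p<p+q (½-pos 0<ε) ⟩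
      ½ ℚ.* ε ℚ.+ ½ ℚ.* ε                 ≡⟨ ½+½ ε ⟩
      ε                                   ∎)
      (distance≲ (h η (½-pos (½-pos 0<ε))) η (½-pos (½-pos 0<ε)))
    where
    open ℚₚ.≤-Reasoning
    η : ℚ
    η = ½ ℚ.* (½ ℚ.* ε)

  ~-refl : ∀ {x r} → 0ℚ ℚ.≤ r → x ~[ r ] x
  ~-refl {x} {r} 0≤r = within (pointwise⇒≲ {‖ x -ᵥ x ‖} λ n → norm≤ (x -ᵥ x) n 0≤r λ i →
    subst (λ z → ℚ.∣ z ∣ ℚ.≤ r) (sym (ℚₚ.+-inverseʳ (seq (x i) n))) 0≤r)

  ≈-refl : ∀ (x : ℝ^ d) → x ≈ᵥ x
  ≈-refl x = ~⇒≈ {x} {x} λ ε 0<ε → ~-refl (ℚₚ.<⇒≤ 0<ε)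

  ≈-sym : ∀ {x y : ℝ^ d} → x ≈ᵥ y → y ≈ᵥ x
  ≈-sym {x} {y} x≈y = ~⇒≈ {y} {x} λ ε 0<ε → ~-sym (≈⇒~ (ℚₚ.<⇒≤ 0<ε) x≈y)

  ~-respˡ : ∀ {x x′ y : ℝ^ d} {r} → x ≈ᵥ x′ → x ~[ r ] y → x′ ~[ r ] y
  ~-respˡ {x} {x′} {y} {r} x≈x′ xy = ~-limit λ ε 0<ε →
    subst (λ s → x′ ~[ s ] y) (ℚₚ.+-comm ε r) (~-trans (~-sym (≈⇒~ (ℚₚ.<⇒≤ 0<ε) x≈x′)) xy)

  ~-respʳ : ∀ {x y y′ : ℝ^ d} {r} → y ≈ᵥ y′ → x ~[ r ] y → x ~[ r ] y′
  ~-respʳ y≈y′ xy = ~-sym (~-respˡ y≈y′ (~-sym xy))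

  ≈-trans : ∀ {x y z : ℝ^ d} → x ≈ᵥ y → y ≈ᵥ z → x ≈ᵥ z
  ≈-trans {x} {y} {z} x≈y y≈z = ~⇒≈ {x} {z} λ ε 0<ε → ~-respʳ y≈z (≈⇒~ {x} {y} (ℚₚ.<⇒≤ 0<ε) x≈y)

  -- The witness `δ` of τ < 1 gives the rational ratio 1 - δ. Allowing every larger `t′` lets
  -- finitely many maps share one ratio; nonnegativity is asked of `t′` because 1 - δ comes with no
  -- sign.
  contraction⇒~ : ∀ {f : ℝ^ d → ℝ^ d} → Contraction f → ∃[ t ] t ℚ.< 1ℚ ×
    (∀ t′ → 0ℚ ℚ.≤ t′ → t′ ℚ.< 1ℚ → t ℚ.≤ t′ → ∀ {x y r} → x ~[ r ] y → f x ~[ t′ ℚ.* r ] f y)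
  contraction⇒~ {f} (τ , _ , (δ , 0<δ , τ+δ<1) , lip) = t , t<1 , λ t′ 0≤t′ t′<1 t≤t′ {x} {y} {r} xy → within λ ε 0<ε →
    zip∞ (λ n τ≤ (p , q) → begin
      dist (f x) (f y) n                        ≤⟨ p ⟩
      seq τ n ℚ.* dist x y n ℚ.+ ½ ℚ.* ε        ≤⟨ ℚₚ.+-monoˡ-≤ (½ ℚ.* ε) (*-monoʳ (dist x y n) (0≤norm (x -ᵥ y) n) (ℚₚ.≤-trans τ≤ t≤t′)) ⟩
      t′ ℚ.* dist x y n ℚ.+ ½ ℚ.* ε             ≤⟨ ℚₚ.+-monoˡ-≤ (½ ℚ.* ε) (*-monoˡ t′ 0≤t′ q) ⟩
      t′ ℚ.* (r ℚ.+ ½ ℚ.* ε) ℚ.+ ½ ℚ.* ε        ≡⟨ cong (ℚ._+ ½ ℚ.* ε) (ℚₚ.*-distribˡ-+ t′ r (½ ℚ.* ε)) ⟩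
      t′ ℚ.* r ℚ.+ t′ ℚ.* (½ ℚ.* ε) ℚ.+ ½ ℚ.* ε ≤⟨ ℚₚ.+-monoˡ-≤ (½ ℚ.* ε) (ℚₚ.+-monoʳ-≤ (t′ ℚ.* r) (*-monoʳ (½ ℚ.* ε) (ℚₚ.<⇒≤ (½-pos 0<ε)) (ℚₚ.<⇒≤ t′<1))) ⟩
      t′ ℚ.* r ℚ.+ 1ℚ ℚ.* (½ ℚ.* ε) ℚ.+ ½ ℚ.* ε ≡⟨ trans (ℚₚ.+-assoc (t′ ℚ.* r) _ _) (cong (t′ ℚ.* r ℚ.+_) (trans (cong (ℚ._+ ½ ℚ.* ε) (ℚₚ.*-identityˡ (½ ℚ.* ε))) (½+½ ε))) ⟩
      t′ ℚ.* r ℚ.+ ε                            ∎)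
    (map∞ τ≤t τ+δ<1)
    (zip∞ (λ _ → _,_)
      (≤⇒eventually {‖ f x -ᵥ f y ‖} {τ * ‖ x -ᵥ y ‖} (lip x y) (½ ℚ.* ε) (½-pos 0<ε))
      (distance≲ xy (½ ℚ.* ε) (½-pos 0<ε)))
    where
    open ℚₚ.≤-Reasoning
    t : ℚ
    t = 1ℚ ℚ.- δ
    t<1 : t ℚ.< 1ℚ
    t<1 = subst (t ℚ.<_) (solve 1 (λ δ → con 1ℚ :- δ :+ δ := con 1ℚ) refl δ) (p<p+q 0<δ)
      where open +-*-Solver
    τ≤t : ∀ n → seq τ n ℚ.+ δ ℚ.< 1ℚ → seq τ n ℚ.≤ t
    τ≤t n h = subst (ℚ._≤ t) (solve 2 (λ a δ → a :+ δ :- δ := a) refl (seq τ n) δ) (ℚₚ.+-monoˡ-≤ (ℚ.- δ) (ℚₚ.<⇒≤ h))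
      where open +-*-Solver

0<fromℚ : ∀ {r} → 0ℚ ℚ.< r → 0ℝ < fromℚ r
0<fromℚ {r} 0<r = ½ ℚ.* r , ½-pos 0<r , always λ _ →
  subst₂ ℚ._<_ (sym (ℚₚ.+-identityˡ (½ ℚ.* r))) (½+½ r) (p<p+q (½-pos 0<r))

-- Geometric decay and common contraction ratios

geometric : ℚ → ℚ → ℕ → ℚ
geometric t R zero    = R
geometric t R (suc n) = t ℚ.* geometric t R n

0≤geometric : ∀ {t R} → 0ℚ ℚ.≤ t → 0ℚ ℚ.≤ R → ∀ n → 0ℚ ℚ.≤ geometric t R n
0≤geometric 0≤t 0≤R zero    = 0≤R
0≤geometric 0≤t 0≤R (suc n) = *-nonNeg 0≤t (0≤geometric 0≤t 0≤R n)

-- Bernoulli's inequality (1/t)ⁿ ≥ 1 + n(1 − t) without division, so that t = 0 is allowed.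
geometric-bernoulli : ∀ {t R} → 0ℚ ℚ.≤ t → 0ℚ ℚ.≤ R → ∀ n →
                      geometric t R n ℚ.* (1ℚ ℚ.+ ιₙ n ℚ.* (1ℚ ℚ.- t)) ℚ.≤ R
geometric-bernoulli {t} {R} 0≤t 0≤R zero =
  ℚₚ.≤-reflexive (trans (cong (λ z → R ℚ.* (1ℚ ℚ.+ z)) (trans (cong (ℚ._* (1ℚ ℚ.- t)) ι-zero) (ℚₚ.*-zeroˡ (1ℚ ℚ.- t)))) (ℚₚ.*-identityʳ R))
geometric-bernoulli {t} {R} 0≤t 0≤R (suc n) = begin
  t ℚ.* g ℚ.* (1ℚ ℚ.+ ιₙ (suc n) ℚ.* (1ℚ ℚ.- t))
    ≡⟨ cong (λ k → t ℚ.* g ℚ.* (1ℚ ℚ.+ k ℚ.* (1ℚ ℚ.- t))) (ι-suc n) ⟩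
  t ℚ.* g ℚ.* (1ℚ ℚ.+ (1ℚ ℚ.+ k) ℚ.* (1ℚ ℚ.- t))
    ≤⟨ p≤p+q (*-nonNeg (0≤geometric 0≤t 0≤R n) (*-nonNeg (ℚₚ.≤-trans (ι-nonNeg (suc n)) (ℚₚ.≤-reflexive (ι-suc n))) (0≤square (1ℚ ℚ.- t)))) ⟩
  t ℚ.* g ℚ.* (1ℚ ℚ.+ (1ℚ ℚ.+ k) ℚ.* (1ℚ ℚ.- t)) ℚ.+ g ℚ.* ((1ℚ ℚ.+ k) ℚ.* ((1ℚ ℚ.- t) ℚ.* (1ℚ ℚ.- t)))
    ≡⟨ solve 3 (λ t g k → t :* g :* (con 1ℚ :+ (con 1ℚ :+ k) :* (con 1ℚ :- t)) :+ g :* ((con 1ℚ :+ k) :* ((con 1ℚ :- t) :* (con 1ℚ :- t))) := g :* (con 1ℚ :+ k :* (con 1ℚ :- t))) refl t g k ⟩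
  g ℚ.* (1ℚ ℚ.+ k ℚ.* (1ℚ ℚ.- t))
    ≤⟨ geometric-bernoulli 0≤t 0≤R n ⟩
  R ∎
  where
  open ℚₚ.≤-Reasoning
  open +-*-Solver
  g k : ℚ
  g = geometric t R n
  k = ιₙ n
  0≤square : ∀ p → 0ℚ ℚ.≤ p ℚ.* p
  0≤square p with ℚₚ.≤-total 0ℚ p
  ... | inj₁ 0≤p = *-nonNeg 0≤p 0≤p
  ... | inj₂ p≤0 = subst (0ℚ ℚ.≤_) (solve 1 (λ p → (:- p) :* (:- p) := p :* p) refl p)
                     (*-nonNeg (ℚₚ.neg-antimono-≤ p≤0) (ℚₚ.neg-antimono-≤ p≤0))

-- Bernoulli's inequality bounds the term by R/(1 + n(1 - t)), and `N` is taken with R ≤ N(1 - t)ε.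
geometric-small : ∀ {t R} → 0ℚ ℚ.≤ t → t ℚ.< 1ℚ → 0ℚ ℚ.≤ R → ∀ ε → 0ℚ ℚ.< ε →
                  Eventually λ n → geometric t R n ℚ.≤ ε
geometric-small {t} {R} 0≤t t<1 0≤R ε 0<ε = N , λ n N≤n →
  ℚₚ.*-cancelʳ-≤-pos (D n) {{ℚ.positive (0<D n)}} (begin
    geometric t R n ℚ.* D n       ≤⟨ geometric-bernoulli 0≤t 0≤R n ⟩
    R                             ≤⟨ proj₂ large ⟩
    ιₙ N ℚ.* (s ℚ.* ε)            ≤⟨ *-monoʳ (s ℚ.* ε) (*-nonNeg 0≤s (ℚₚ.<⇒≤ 0<ε)) (ιₙ-mono-≤ N n N≤n) ⟩
    ιₙ n ℚ.* (s ℚ.* ε)            ≤⟨ p≤p+q (ℚₚ.<⇒≤ 0<ε) ⟩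
    ιₙ n ℚ.* (s ℚ.* ε) ℚ.+ ε      ≡⟨ rearrange (ιₙ n) s ε ⟩
    ε ℚ.* D n                     ∎)
  where
  open ℚₚ.≤-Reasoning
  open +-*-Solver
  s : ℚ
  s = 1ℚ ℚ.- t
  0≤s : 0ℚ ℚ.≤ s
  0≤s = ℚₚ.<⇒≤ (0<q-p t<1)
  large : ∃[ N ] R ℚ.≤ ιₙ N ℚ.* (s ℚ.* ε)
  large = archimedean R (s ℚ.* ε) (*-pos (0<q-p t<1) 0<ε)
  N : ℕ
  N = proj₁ large
  D : ℕ → ℚ
  D n = 1ℚ ℚ.+ ιₙ n ℚ.* s
  0<D : ∀ n → 0ℚ ℚ.< D n
  0<D n = ℚₚ.<-≤-trans (ℚₚ.positive⁻¹ 1ℚ) (p≤p+q (*-nonNeg (ι-nonNeg n) 0≤s))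
  rearrange : ∀ k s ε → k ℚ.* (s ℚ.* ε) ℚ.+ ε ≡ ε ℚ.* (1ℚ ℚ.+ k ℚ.* s)
  rearrange = solve 3 (λ k s ε → k :* (s :* ε) :+ ε := ε :* (con 1ℚ :+ k :* s)) refl

uniform-bound : ∀ m (g : Fin m → ℚ) → (∀ i → g i ℚ.< 1ℚ) →
                ∃[ t ] 0ℚ ℚ.≤ t × t ℚ.< 1ℚ × (∀ i → g i ℚ.≤ t)
-- Starting the maximum at 0 makes the common ratio nonnegative.
uniform-bound zero    g g<1 = 0ℚ , ℚₚ.≤-refl , ℚₚ.positive⁻¹ 1ℚ , λ ()
uniform-bound (suc m) g g<1 with uniform-bound m (g ∘ suc) (g<1 ∘ suc)
... | t , 0≤t , t<1 , g≤t = g zero ℚ.⊔ t , ℚₚ.≤-trans 0≤t (ℚₚ.p≤q⊔p (g zero) t) , ⊔<1 (ℚₚ.⊔-sel (g zero) t) ,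
    λ { zero → ℚₚ.p≤p⊔q (g zero) t ; (suc i) → ℚₚ.≤-trans (g≤t i) (ℚₚ.p≤q⊔p (g zero) t) }
  where
  ⊔<1 : g zero ℚ.⊔ t ≡ g zero ⊎ g zero ℚ.⊔ t ≡ t → g zero ℚ.⊔ t ℚ.< 1ℚ
  ⊔<1 (inj₁ e) = subst (ℚ._< 1ℚ) (sym e) (g<1 zero)
  ⊔<1 (inj₂ e) = subst (ℚ._< 1ℚ) (sym e) t<1

-- For `compose`, whose additional map acts innermost and thus multiplies the initial radius by `t`.
geometric-*ʳ : ∀ t R n → geometric t (t ℚ.* R) n ≡ t ℚ.* geometric t R n
geometric-*ʳ t R zero    = refl
geometric-*ʳ t R (suc n) = cong (t ℚ.*_) (geometric-*ʳ t R n)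

another : ∀ {n} {i j : Fin n} → i ≢ j → ∀ k → Σ[ l ∈ Fin n ] l ≢ k
another {i = i} {j} i≢j k with k Finₚ.≟ i
... | yes refl = j , i≢j ∘ sym
... | no  k≢i  = i , k≢i ∘ sym

~⇒⟶ : ∀ {d} (s : ℕ → ℝ^ d) (x : ℝ^ d) → (∀ r → 0ℚ ℚ.< r → Eventually λ n → s n ~[ r ] x) → s ⟶ᵥ x
~⇒⟶ s x h ε 0<ε =
  let r , 0<r , below = below-positive {ε} 0<ε
  in map∞ (λ n near → below ∣ ‖ s n -ᵥ x ‖ ∣ λ η 0<η → map∞
       (λ k → subst (ℚ._≤ r ℚ.+ η) (sym (trans (p⊔-p≡∣p∣ (seq ‖ s n -ᵥ x ‖ k)) (ℚₚ.0≤p⇒∣p∣≡p (0≤norm (s n -ᵥ x) k)))))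
       (distance≲ near η 0<η))
     (h r 0<r)

-- Compactness and Baire category

module Classical (em : ExcludedMiddle 0ℓ) where

  byContradiction : {P : Set} → ¬ ¬ P → P
  byContradiction = decidable-stable em

  ¬∀⇒∃¬ : {A : Set} {P : A → Set} → ¬ (∀ a → P a) → ∃[ a ] ¬ P a
  ¬∀⇒∃¬ ¬all = byContradiction λ ¬∃ → ¬all λ a → byContradiction λ ¬p → ¬∃ (a , ¬p)

  module _ {d : ℕ} where

    ≉⇒apart : ∀ {x y : ℝ^ d} → ¬ x ≈ᵥ y → ∃[ ρ ] 0ℚ ℚ.< ρ × ¬ x ~[ ρ ] y
    ≉⇒apart {x} {y} x≉y = byContradiction λ none → x≉y (~⇒≈ {d} {x} {y} λ ρ 0<ρ →
      byContradiction λ apart → none (ρ , 0<ρ , apart))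

    ≁⇒slack : ∀ {x y : ℝ^ d} {r} → ¬ x ~[ r ] y → ∃[ δ ] 0ℚ ℚ.< δ × ¬ x ~[ r ℚ.+ δ ] y
    ≁⇒slack x≁y = byContradiction λ none → x≁y (~-limit λ δ 0<δ →
      byContradiction λ apart → none (δ , 0<δ , apart))

    outside-open : ∀ (a : ℝ^ d) r → Open λ z → ¬ z ~[ r ] a
    outside-open a r z z≁a = let δ , 0<δ , z≁′a = ≁⇒slack z≁a in
      fromℚ δ , 0<fromℚ 0<δ , λ y y-z<δ y~a → z≁′a
        (subst (λ s → z ~[ s ] a) (ℚₚ.+-comm δ r)
          (~-trans (~-sym (<⇒~ {r = δ} y-z<δ)) y~a))

    -- Openness of the ball is encoded by a witness `s` strictly below `r`; spending half of the gap
    -- r - s keeps the new witness below `r`.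
    inside-open : ∀ (a : ℝ^ d) r → Open λ z → ∃[ s ] s ℚ.< r × z ~[ s ] a
    inside-open a r z (s , s<r , z~a) = fromℚ δ , 0<fromℚ 0<δ , λ y y-z<δ →
      δ ℚ.+ s , δ+s<r , ~-trans (<⇒~ {r = δ} y-z<δ) z~a
      where
      δ : ℚ
      δ = ½ ℚ.* (r ℚ.- s)
      0<δ : 0ℚ ℚ.< δ
      0<δ = ½-pos (0<q-p s<r)
      open ℚₚ.≤-Reasoning
      δ+s<r : δ ℚ.+ s ℚ.< r
      δ+s<r = begin-strict
        δ ℚ.+ s               ≡⟨ ℚₚ.+-comm δ s ⟩
        s ℚ.+ δ               <⟨ ℚₚ.+-monoʳ-< s (p<p+q 0<δ) ⟩
        s ℚ.+ (δ ℚ.+ δ)       ≡⟨ cong (s ℚ.+_) (½+½ (r ℚ.- s)) ⟩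
        s ℚ.+ (r ℚ.- s)       ≡⟨ p+[q-p] s r ⟩
        r                     ∎

    module CompactSet (C : Pred (ℝ^ d) 0ℓ) (compact : Compact C) where

      -- Otherwise the complements of the balls cover C. If `m` bounds the indices of a finite
      -- subcover, then `x m` lies in all of those balls, yet also in one of the complements. The
      -- points `x m` witness the finite stages, which suits both the nested balls of `baire` and an
      -- orbit tending to a fixed point.
      ball-intersection : ∀ (a : ℕ → ℝ^ d) (r : ℕ → ℚ) (x : ℕ → ℝ^ d) → (∀ m → x m ∈ C) →
                          (∀ m n → n ℕ.≤ m → x m ~[ r n ] a n) →
                          ∃[ z ] z ∈ C × (∀ n → z ~[ r n ] a n)
      ball-intersection a r x x∈C x~a = byContradiction λ none →
        let ns , cover = compact (λ n z → ¬ z ~[ r n ] a n) (λ n → outside-open (a n) (r n))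
                           (λ {z} z∈C → ¬∀⇒∃¬ λ all → none (z , z∈C , all))
            m = max 0 ns
        in All.lookupWith {R = λ _ → ⊥} (λ {n} n≤m x≁a → x≁a (x~a m n n≤m)) (xs≤max 0 ns) (cover (x∈C m))

      -- The open balls around `a` with rational radius cover C; the largest radius in a finite
      -- subcover works, and the default 0 of the maximum gives 0 ≤ R.
      bounded : ∀ a → ∃[ R ] 0ℚ ℚ.≤ R × (∀ {z} → z ∈ C → z ~[ R ] a)
      bounded a =
        let rs , cover = compact (λ r z → ∃[ s ] s ℚ.< r × z ~[ s ] a) (inside-open a)
                           (λ {z} _ → let s , z~a = ~-bounded z a in
                             s ℚ.+ 1ℚ , s , p<p+q (ℚₚ.positive⁻¹ 1ℚ) , z~a)
            R = maxℚ 0ℚ rs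
        in R , ⊥≤max 0ℚ rs , λ {z} z∈C →
           All.lookupWith {R = λ _ → z ~[ R ] a} (λ { r≤R (s , s<r , z~a) → ~-mono (ℚₚ.≤-trans (ℚₚ.<⇒≤ s<r) r≤R) z~a })
             (xs≤maxℚ 0ℚ rs) (cover z∈C)

      record Ball : Set where
        constructor ball
        field
          center   : ℝ^ d
          center∈C : center ∈ C
          radius   : ℚ
          0<radius : 0ℚ ℚ.< radius

      open Ball public

      infix 4 _∈ᵇ_ _⊆ᵇ_

      _∈ᵇ_ : ℝ^ d → Ball → Set
      z ∈ᵇ b = z ~[ radius b ] center b

      _⊆ᵇ_ : Ball → Ball → Set
      b ⊆ᵇ b′ = ∀ {z} → z ∈ᵇ b → z ∈ᵇ b′

      center∈ᵇ : ∀ b → center b ∈ᵇ b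
      center∈ᵇ b = ~-refl (ℚₚ.<⇒≤ (0<radius b))

      -- The union of the balls `b′` is the dense open set. Choosing `b′` as a function of `b`
      -- allows the choice to be iterated.
      ContainsDenseOpen : Pred (ℝ^ d) 0ℓ → Set
      ContainsDenseOpen P = ∀ b → Σ[ b′ ∈ Ball ] b′ ⊆ᵇ b × (∀ {z} → z ∈ᵇ b′ → z ∈ P)

      half : Ball → Ball
      half b = record b { radius = ½ ℚ.* radius b ; 0<radius = ½-pos (0<radius b) }

      recenter : ∀ b {y} → y ∈ C → y ∈ᵇ half b → Σ[ b′ ∈ Ball ] center b′ ≡ y × b′ ⊆ᵇ b
      recenter b {y} y∈C y∈ = ball y y∈C (½ ℚ.* radius b) (½-pos (0<radius b)) , refl ,
        λ {z} z~y → subst (λ r → z ~[ r ] center b) (½+½ (radius b)) (~-trans z~y y∈)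

      shrink : ∀ b s → 0ℚ ℚ.< s → Σ[ b′ ∈ Ball ] b′ ⊆ᵇ b × (∀ {z} → z ∈ᵇ b′ → z ~[ s ] center b)
      shrink b s 0<s = record b { radius = radius b ℚ.⊓ s ; 0<radius = 0<⊓ (ℚₚ.⊓-sel (radius b) s) } ,
        ~-mono (ℚₚ.p⊓q≤p (radius b) s) , ~-mono (ℚₚ.p⊓q≤q (radius b) s)
        where
        0<⊓ : radius b ℚ.⊓ s ≡ radius b ⊎ radius b ℚ.⊓ s ≡ s → 0ℚ ℚ.< radius b ℚ.⊓ s
        0<⊓ (inj₁ e) = subst (0ℚ ℚ.<_) (sym e) (0<radius b)
        0<⊓ (inj₂ e) = subst (0ℚ ℚ.<_) (sym e) 0<s

      _∩-dense_ : ∀ {P Q : Pred (ℝ^ d) 0ℓ} → ContainsDenseOpen P → ContainsDenseOpen Q →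
                  ContainsDenseOpen (λ z → z ∈ P × z ∈ Q)
      (denseP ∩-dense denseQ) b =
        let b₁ , b₁⊆b , b₁⊆P = denseP b
            b₂ , b₂⊆b₁ , b₂⊆Q = denseQ b₁
        in b₂ , (λ z∈ → b₁⊆b (b₂⊆b₁ z∈)) , λ z∈ → b₁⊆P (b₂⊆b₁ z∈) , b₂⊆Q z∈

      -- Each ball is chosen inside its predecessor, and the centers, which lie in C, witness the
      -- finite stages. Compactness, instead of shrinking radii and completeness, supplies the
      -- common point.
      baire : ∀ (P : ℕ → Pred (ℝ^ d) 0ℓ) → (∀ n → ContainsDenseOpen (P n)) →
              ∀ b → ∃[ z ] z ∈ C × z ∈ᵇ b × (∀ n → z ∈ P n)
      baire P dense b =
        let z , z∈C , z∈ = ball-intersection (center ∘ balls) (radius ∘ balls) (center ∘ balls)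
                             (center∈C ∘ balls) (λ m n n≤m → nested (ℕₚ.≤⇒≤′ n≤m) (center∈ᵇ (balls m)))
        -- Ball n + 1 is the one on which `P n` holds, hence the shift.
        in z , z∈C , z∈ 0 , λ n → proj₂ (proj₂ (dense n (balls n))) (z∈ (suc n))
        where
        balls : ℕ → Ball
        balls zero    = b
        balls (suc n) = proj₁ (dense n (balls n))
        nested : ∀ {m n} → n ℕ.≤′ m → balls m ⊆ᵇ balls n
        nested ℕ.≤′-refl       z∈ = z∈
        nested {suc m} (ℕ.≤′-step n≤m) z∈ = nested n≤m (proj₁ (proj₂ (dense m (balls m))) z∈)

      Perfect : Set
      Perfect = ∀ b → ∃[ y ] y ∈ C × y ∈ᵇ b × ¬ y ≈ᵥ center b

      -- Take a point of C in the half ball that differs from `e`: the center, or a neighbour of it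
      -- if the center is `e`. A small ball around that point misses `e`.
      avoid-dense : Perfect → ∀ e → ContainsDenseOpen (λ z → ¬ z ≈ᵥ e)
      avoid-dense perfect e b =
        let a , a∈C , a∈ , a≉e  = off-e
            b₁ , center≡a , b₁⊆b = recenter b a∈C a∈
            ρ , 0<ρ , a≁e       = ≉⇒apart {a} {e} a≉e
            b₂ , b₂⊆b₁ , b₂⊆ρ   = shrink b₁ ρ 0<ρ
        in b₂ , (λ z∈ → b₁⊆b (b₂⊆b₁ z∈)) , λ z∈ z≈e →
             a≁e (~-sym (~-respˡ z≈e (subst (λ y → _ ~[ ρ ] y) center≡a (b₂⊆ρ z∈))))
        where
        off-e : ∃[ a ] a ∈ C × a ∈ᵇ half b × ¬ a ≈ᵥ e
        off-e with em {center b ≈ᵥ e}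
        ... | no  c≉e = center b , center∈C b , center∈ᵇ (half b) , c≉e
        ... | yes c≈e = let y , y∈C , y∈ , y≉c = perfect (half b) in
          y , y∈C , y∈ , λ y≈e → y≉c (≈-trans {d} {y} {e} {center b} y≈e (≈-sym {d} {center b} {e} c≈e))

  -- The attractor

  module Attracting {d : ℕ} (F : IFS d) (C : Pred (ℝ^ d) 0ℓ) (attractor : Attractor F C) where
    open IFS F

    compact : Compact C
    compact = proj₁ (proj₂ attractor)

    open CompactSet C compact public

    f∈C : ∀ j {x} → x ∈ C → f j x ∈ C
    f∈C j {x} x∈C = proj₁ (proj₂ (proj₂ attractor)) (j , x , x∈C , ≈-refl (f j x))

    preimage : ∀ {x} → x ∈ C → Σ[ j ∈ Fin J ] Σ[ y ∈ ℝ^ d ] y ∈ C × f j y ≈ᵥ x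
    preimage = proj₂ (proj₂ (proj₂ attractor))

    ≈-closed : ∀ {x y} → x ≈ᵥ y → x ∈ C → y ∈ C
    ≈-closed {x} {y} x≈y x∈C = let j , z , z∈C , fz≈x = preimage x∈C in
      proj₁ (proj₂ (proj₂ attractor)) (j , z , z∈C , ≈-trans {d} {f j z} {x} {y} fz≈x x≈y)

    c₀ : ℝ^ d
    c₀ = proj₁ (proj₁ attractor)

    c₀∈C : c₀ ∈ C
    c₀∈C = proj₂ (proj₁ attractor)

    private
      ratio-of : ∀ j → _
      ratio-of j = contraction⇒~ {d} {f j} (contraction j)
      uniform : ∃[ t ] 0ℚ ℚ.≤ t × t ℚ.< 1ℚ × (∀ j → proj₁ (ratio-of j) ℚ.≤ t)
      uniform = uniform-bound J (proj₁ ∘ ratio-of) (λ j → proj₁ (proj₂ (ratio-of j)))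

    abstract
      t : ℚ
      t = proj₁ uniform

      0≤t : 0ℚ ℚ.≤ t
      0≤t = proj₁ (proj₂ uniform)

      t<1 : t ℚ.< 1ℚ
      t<1 = proj₁ (proj₂ (proj₂ uniform))

      f-contracts : ∀ j {x y r} → x ~[ r ] y → f j x ~[ t ℚ.* r ] f j y
      f-contracts j = proj₂ (proj₂ (ratio-of j)) t 0≤t t<1 (proj₂ (proj₂ (proj₂ uniform)) j)

    abstract
      diameter : ∃[ R ] 0ℚ ℚ.≤ R × (∀ {x y} → x ∈ C → y ∈ C → x ~[ R ] y)
      diameter = let r , 0≤r , near = bounded c₀ in
        r ℚ.+ r , ℚₚ.≤-trans 0≤r (p≤p+q 0≤r) , λ x∈C y∈C → ~-trans (near x∈C) (~-sym (near y∈C))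

    R : ℚ
    R = proj₁ diameter

    0≤R : 0ℚ ℚ.≤ R
    0≤R = proj₁ (proj₂ diameter)

    within-R : ∀ {x y} → x ∈ C → y ∈ C → x ~[ R ] y
    within-R = proj₂ (proj₂ diameter)

    tⁿR-small : ∀ ε → 0ℚ ℚ.< ε → Eventually λ n → geometric t R n ℚ.≤ ε
    tⁿR-small = geometric-small 0≤t t<1 0≤R

    -- Rational points of the attractor

    -- The orbit of `c₀` under `f j` stays in C and tends to `α` geometrically. Compactness then
    -- yields a point of C within every one of these radii of `α`, which must be `α`.
    fixed-point∈C : ∀ j α → f j α ≈ᵥ α → α ∈ C
    fixed-point∈C j α fα≈α =
      let z , z∈C , z~α = ball-intersection (λ _ → α) (geometric t R′) orbit orbit∈C near
      in ≈-closed {z} {α} (~⇒≈ {d} {z} {α} λ ε 0<ε →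
           let N , small = geometric-small 0≤t t<1 0≤R′ ε 0<ε
           in ~-mono (small N ℕₚ.≤-refl) (z~α N)) z∈C
      where
      R′ : ℚ
      R′ = proj₁ (bounded α)
      0≤R′ : 0ℚ ℚ.≤ R′
      0≤R′ = proj₁ (proj₂ (bounded α))
      orbit : ℕ → ℝ^ d
      orbit zero    = c₀
      orbit (suc m) = f j (orbit m)
      orbit∈C : ∀ m → orbit m ∈ C
      orbit∈C zero    = c₀∈C
      orbit∈C (suc m) = f∈C j (orbit∈C m)
      near : ∀ m n → n ℕ.≤ m → orbit m ~[ geometric t R′ n ] α
      near m       zero    _           = proj₂ (proj₂ (bounded α)) (orbit∈C m)
      near (suc m) (suc n) (ℕ.s≤s n≤m) = ~-respʳ fα≈α (f-contracts j (near m n n≤m))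

    -- Pull `x` back through n maps and push the rational fixed point forward through the same maps:
    -- rationality survives, and each map multiplies the distance by at most `t`.
    rationals-approximate : RationalPreserving F → RationalFixedPoint F → ∀ n {x} → x ∈ C →
                            ∃[ β ] β ∈ C × Rational β × β ~[ geometric t R n ] x
    rationals-approximate preserves (j , α , fα≈α , α-rational) zero x∈C =
      let α∈C = fixed-point∈C j α fα≈α in α , α∈C , α-rational , within-R α∈C x∈C
    rationals-approximate preserves fixed (suc n) {x} x∈C =
      let j , y , y∈C , fy≈x            = preimage x∈C
          β , β∈C , β-rational , β~y = rationals-approximate preserves fixed n y∈C
      in f j β , f∈C j β∈C , preserves j β β-rational , ~-respʳ fy≈x (f-contracts j β~y)

    rationals-dense : RationalPreserving F → RationalFixedPoint F → ∀ b →
                      ∃[ β ] β ∈ C × Rational β × β ∈ᵇ b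
    rationals-dense preserves fixed b =
      let N , small = tⁿR-small (radius b) (0<radius b)
          β , β∈C , β-rational , β~ = rationals-approximate preserves fixed N (center∈C b)
      in β , β∈C , β-rational , ~-mono (small N ℕₚ.≤-refl) β~

    -- Perfectness of the attractor

    -- Pull the center back through n maps. One of `u`, `v` differs from the point reached, and
    -- pushing it forward by injective maps keeps it different while bringing it close.
    one-to-one⇒perfect : NonDegenerate C → OneToOne F → Perfect
    one-to-one⇒perfect (u , v , u∈C , v∈C , u≉v) injective b =
      let N , small = tⁿR-small (radius b) (0<radius b)
          y , y∈C , y~ , y≉ = companion N (center∈C b)
      in y , y∈C , ~-mono (small N ℕₚ.≤-refl) y~ , y≉
      where
      companion : ∀ n {x} → x ∈ C → ∃[ y ] y ∈ C × y ~[ geometric t R n ] x × ¬ y ≈ᵥ x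
      companion zero {x} x∈C with em {u ≈ᵥ x}
      ... | no  u≉x = u , u∈C , within-R u∈C x∈C , u≉x
      ... | yes u≈x = v , v∈C , within-R v∈C x∈C , λ v≈x →
        u≉v (≈-trans {d} {u} {x} {v} u≈x (≈-sym {d} {v} {x} v≈x))
      companion (suc n) {x} x∈C =
        let j , y , y∈C , fy≈x  = preimage x∈C
            z , z∈C , z~y , z≉y = companion n y∈C
        in f j z , f∈C j z∈C , ~-respʳ fy≈x (f-contracts j z~y) , λ fz≈x →
             z≉y (injective j (≈-trans {d} {f j z} {x} {f j y} fz≈x (≈-sym {d} {f j y} {x} fy≈x)))

    -- With at most one index, any two points of C have preimages in C under the same map at every
    -- level, so their distance is at most tⁿR for all n and C has only one point.
    two-maps : NonDegenerate C → Σ[ i ∈ Fin J ] Σ[ j ∈ Fin J ] i ≢ j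
    two-maps (u , v , u∈C , v∈C , u≉v) = byContradiction λ none → u≉v
      (~⇒≈ {d} {u} {v} λ ε 0<ε → let N , small = tⁿR-small ε 0<ε in
        ~-mono (small N ℕₚ.≤-refl) (close (λ i j → byContradiction λ i≢j → none (i , j , i≢j)) N u∈C v∈C))
      where
      close : (∀ (i j : Fin J) → i ≡ j) → ∀ n {x y} → x ∈ C → y ∈ C → x ~[ geometric t R n ] y
      close same zero    x∈C y∈C = within-R x∈C y∈C
      close same (suc n) x∈C y∈C with preimage x∈C | preimage y∈C
      ... | i , x′ , x′∈C , fx′≈x | j , y′ , y′∈C , fy′≈y with refl ← same i j =
        ~-respˡ fx′≈x (~-respʳ fy′≈y (f-contracts i (close same n x′∈C y′∈C)))

    -- Addresses and cylinders

    prepend : Fin J → (ℕ → Fin J) → ℕ → Fin J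
    prepend j ω zero    = j
    prepend j ω (suc i) = ω i

    -- `compose` grows at the innermost map, whereas pulling a point back reveals the outermost map
    -- first; this reconciles the two orders.
    compose-prepend : ∀ j ω n x → compose F (prepend j ω) (suc n) x ≡ f j (compose F ω n x)
    compose-prepend j ω zero    x = refl
    compose-prepend j ω (suc n) x = compose-prepend j ω n (f (ω n) x)

    compose∈C : ∀ ω n {x} → x ∈ C → compose F ω n x ∈ C
    compose∈C ω zero    x∈C = x∈C
    compose∈C ω (suc n) x∈C = compose∈C ω n (f∈C (ω n) x∈C)

    compose-contracts : ∀ ω n {x y r} → x ~[ r ] y → compose F ω n x ~[ geometric t r n ] compose F ω n y
    compose-contracts ω zero    x~y = x~y
    compose-contracts ω (suc n) {r = r} x~y =
      subst (λ s → _ ~[ s ] _) (geometric-*ʳ t r n) (compose-contracts ω n (f-contracts (ω n) x~y))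

    -- The first n letters of an address of `x`, encoded as the operation of writing them in front
    -- of a sequence. Every cylinder with these letters lies within tⁿR of `x`. The index n + k, in
    -- this order, computes along `prepend`.
    record Prefix (n : ℕ) (x : ℝ^ d) : Set where
      field
        extend    : (ℕ → Fin J) → ℕ → Fin J
        extend-+  : ∀ σ k → extend σ (n ℕ.+ k) ≡ σ k
        cylinder  : ∀ σ {i c} → n ℕ.≤ i → c ∈ C → compose F (extend σ) i c ~[ geometric t R n ] x

    open Prefix

    prefix : ∀ n {x} → x ∈ C → Prefix n x
    prefix zero x∈C = record
      { extend   = id
      ; extend-+ = λ _ _ → refl
      ; cylinder = λ σ {i} _ c∈C → within-R (compose∈C σ i c∈C) x∈C
      }
    prefix (suc n) x∈C = let j , y , y∈C , fy≈x = preimage x∈C ; w = prefix n y∈C in record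
      { extend   = prepend j ∘ extend w
      ; extend-+ = extend-+ w
      ; cylinder = λ { σ {suc i} {c} (ℕ.s≤s n≤i) c∈C → ~-respʳ fy≈x
          (subst (λ z → z ~[ _ ] f j y) (sym (compose-prepend j (extend w σ) i c))
            (f-contracts j (cylinder w σ n≤i c∈C))) }
      }

    -- Addresses are defined through images of 0, which may lie outside C. These approach the images
    -- of `c₀`, and the latter equal `x` from level n on.
    constant-cylinder⇒address : ∀ {n x} (w : Prefix n x) σ →
      (∀ i {c} → n ℕ.≤ i → c ∈ C → compose F (extend w σ) i c ≈ᵥ x) → Address F x (extend w σ)
    constant-cylinder⇒address {n} {x} w σ constant = ~⇒⟶ (λ i → compose F (extend w σ) i 0ᵥ) x λ r 0<r →
      zip∞ (λ i n≤i small → ~-mono small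
             (~-respʳ (constant i n≤i c₀∈C) (compose-contracts (extend w σ) i 0~c₀)))
        (n , λ _ n≤i → n≤i)
        (geometric-small 0≤t t<1 0≤R₀ r 0<r)
      where
      R₀ : ℚ
      R₀ = proj₁ (bounded 0ᵥ)
      0≤R₀ : 0ℚ ℚ.≤ R₀
      0≤R₀ = proj₁ (proj₂ (bounded 0ᵥ))
      0~c₀ : 0ᵥ ~[ R₀ ] c₀
      0~c₀ = ~-sym (proj₂ (proj₂ (bounded 0ᵥ)) c₀∈C)

    different : NonDegenerate C → ∀ j → Σ[ i ∈ Fin J ] i ≢ j
    different nondegenerate = let _ , _ , i≢j = two-maps nondegenerate in another i≢j

    -- An isolated point equals a whole cylinder, so every continuation of one of
    -- its addresses is again an address; diagonalise against an enumeration.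
    countable-addresses⇒perfect : NonDegenerate C → CountablyManyAddresses F C → Perfect
    countable-addresses⇒perfect nondegenerate countable b = byContradiction impossible
      where
      n : ℕ
      n = proj₁ (tⁿR-small (radius b) (0<radius b))
      w : Prefix n (center b)
      w = prefix n (center∈C b)
      e : ℕ → ℕ → Fin J
      e = proj₁ (countable (center b) (center∈C b))
      σ : ℕ → Fin J
      σ k = proj₁ (different nondegenerate (e k (n ℕ.+ k)))
      impossible : ¬ ¬ (∃[ y ] y ∈ C × y ∈ᵇ b × ¬ y ≈ᵥ center b)
      impossible none = proj₂ (different nondegenerate (e m (n ℕ.+ m)))
        (sym (trans (proj₂ found (n ℕ.+ m)) (extend-+ w σ m)))
        where
        isolated : ∀ {y} → y ∈ C → y ∈ᵇ b → y ≈ᵥ center b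
        isolated {y} y∈C y∈b = byContradiction λ y≉x → none (y , y∈C , y∈b , y≉x)
        constant : ∀ i {c} → n ℕ.≤ i → c ∈ C → compose F (extend w σ) i c ≈ᵥ center b
        constant i n≤i c∈C = isolated (compose∈C (extend w σ) i c∈C)
          (~-mono (proj₂ (tⁿR-small (radius b) (0<radius b)) n ℕₚ.≤-refl) (cylinder w σ n≤i c∈C))
        found : ∃[ m ] ∀ i → e m i ≡ extend w σ i
        found = proj₂ (countable (center b) (center∈C b)) (extend w σ) (constant-cylinder⇒address w σ constant)
        m : ℕ
        m = proj₁ found

  -- Approximation by rational vectors

  module Approximation {d : ℕ} (C : Pred (ℝ^ d) 0ℓ) (compact : Compact C)
                       (≈-closed : ∀ {x y} → x ≈ᵥ y → x ∈ C → y ∈ C)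
                       (Φ : ℕ → ℝ) (Φ⟶0 : Φ ⟶0) where
    open CompactSet C compact

    -- Here `v` is 1/(bQ), specified by its equation. Distinct vectors differ in some coordinate,
    -- where they are at least 1/(bq) ≥ 1/(bQ) apart.
    rationals-apart : ∀ (p p′ : Vector ℤ d) b q Q .{{_ : NonZero b}} .{{_ : NonZero q}} {v} →
                      q ℕ.≤ Q → v ℚ.* (ιₙ b ℚ.* ιₙ Q) ≡ 1ℚ → 0ℚ ℚ.< ιₙ Q →
                      ¬ p /ᵥ b ≈ᵥ p′ /ᵥ q → ∀ n → v ℚ.≤ dist (p /ᵥ b) (p′ /ᵥ q) n
    rationals-apart p p′ b q Q {v} q≤Q vbQ≡1 0<Q p/b≉p′/q n =
      ℚₚ.≤-trans v≤∣x-y∣ (∣coordinate∣≤norm (p /ᵥ b -ᵥ p′ /ᵥ q) i n)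
      where
      differ : ∃[ i ] ¬ p i ℚ./ b ≡ p′ i ℚ./ q
      differ = ¬∀⇒∃¬ λ same → p/b≉p′/q λ i →
        subst (λ y → fromℚ (p i ℚ./ b) ≈ fromℚ y) (same i) (≈-refl (p /ᵥ b) i)
      i : Fin d
      i = proj₁ differ
      x-y : ℚ
      x-y = p i ℚ./ b ℚ.- p′ i ℚ./ q
      open ℚₚ.≤-Reasoning
      v≤∣x-y∣ : v ℚ.≤ ℚ.∣ x-y ∣
      v≤∣x-y∣ = ℚₚ.*-cancelʳ-≤-pos (ιₙ b ℚ.* ιₙ Q) {{ℚ.positive (*-pos (ι-pos b) 0<Q)}} (begin
        v ℚ.* (ιₙ b ℚ.* ιₙ Q)            ≡⟨ vbQ≡1 ⟩
        1ℚ                               ≤⟨ fractions-apart (p i) b (p′ i) q (proj₂ differ) ⟩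
        ℚ.∣ x-y ∣ ℚ.* (ιₙ b ℚ.* ιₙ q)    ≤⟨ *-monoˡ ℚ.∣ x-y ∣ (ℚₚ.0≤∣p∣ x-y) (*-monoˡ (ιₙ b) (ι-nonNeg b) (ιₙ-mono-≤ q Q q≤Q)) ⟩
        ℚ.∣ x-y ∣ ℚ.* (ιₙ b ℚ.* ιₙ Q)    ∎)

    -- ξ is much closer to the rational vector p/b ∈ C than 1/(bQ); here s = 1/(4bQ).
    record NearRational (N : ℕ) (ξ : ℝ^ d) : Set where
      field
        p     : Vector ℤ d
        b Q   : ℕ
        {{b≢0}} : NonZero b
        {{Q≢0}} : NonZero Q
        s     : ℚ
        N≤Q   : N ℕ.≤ Q
        p/b∈C : p /ᵥ b ∈ C
        0<s   : 0ℚ ℚ.< s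
        4sbQ  : (s ℚ.+ s ℚ.+ (s ℚ.+ s)) ℚ.* (ιₙ b ℚ.* ιₙ Q) ≡ 1ℚ
        Φ≤sQ  : Eventually λ n → seq (Φ Q) n ℚ.≤ s ℚ.* ιₙ Q
        ξ~p/b : ξ ~[ s ] p /ᵥ b
        ξ≉p/b : ¬ ξ ≈ᵥ p /ᵥ b

      apart : ∀ p′ q .{{_ : NonZero q}} → q ℕ.≤ Q → ¬ p /ᵥ b ≈ᵥ p′ /ᵥ q → ∀ n →
              s ℚ.+ s ℚ.+ (s ℚ.+ s) ℚ.≤ dist (p /ᵥ b) (p′ /ᵥ q) n
      apart p′ q q≤Q = rationals-apart p p′ b q Q q≤Q 4sbQ (ι-pos Q)

    -- Since p/b is in C and p′/q is not, they are at least 4s apart. Up to slack s/2, `ξ` is within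
    -- `s` of p/b, so it stays at least 2s away from p′/q, while Φ(Q)/Q ≤ s; a gap s/2 proves the
    -- strict inequality.
    poorlyApproximable : ∀ {ξ} → (∀ N → NearRational N ξ) → PoorlyApproximable C Φ ξ
    poorlyApproximable {ξ} near N = Q r , N≤Q r , Q≢0 r , far
      where
      open NearRational
      r : NearRational N ξ
      r = near N
      σ : ℚ
      σ = s r
      Q⁻¹ : ℚ
      Q⁻¹ = (ℤ.+ 1 ℚ./ Q r) {{Q≢0 r}}
      far : ∀ p′ q .{{_ : NonZero q}} → q ℕ.≤ Q r → (p′ /ᵥ q) ∉ C →
            (Φ (Q r) ÷ℕ Q r) {{Q≢0 r}} < ‖ ξ -ᵥ p′ /ᵥ q ‖
      far p′ q q≤Q p′/q∉C = ½ ℚ.* σ , ½-pos (0<s r) ,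
        zip∞ estimate (Φ≤sQ r) (distance≲ (~-sym (ξ~p/b r)) (½ ℚ.* σ) (½-pos (0<s r)))
        where
        open ℚₚ.≤-Reasoning
        open +-*-Solver
        α : ℝ^ d
        α = (p r /ᵥ b r) {{b≢0 r}}
        α≉ : ¬ α ≈ᵥ p′ /ᵥ q
        α≉ α≈ = p′/q∉C (≈-closed {α} {p′ /ᵥ q} α≈ (p/b∈C r))
        h : ℚ
        h = ½ ℚ.* σ
        estimate : ∀ n → seq (Φ (Q r)) n ℚ.≤ σ ℚ.* ιₙ (Q r) → dist α ξ n ℚ.≤ σ ℚ.+ h →
                   seq (Φ (Q r)) n ℚ.* Q⁻¹ ℚ.+ h ℚ.< dist ξ (p′ /ᵥ q) n
        estimate n Φ≤ close = begin-strict
          seq (Φ (Q r)) n ℚ.* Q⁻¹ ℚ.+ h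
            ≤⟨ ℚₚ.+-monoˡ-≤ h (*-monoʳ Q⁻¹ (ℚₚ.<⇒≤ (0<1/ (Q r) {{Q≢0 r}})) Φ≤) ⟩
          σ ℚ.* ιₙ (Q r) ℚ.* Q⁻¹ ℚ.+ h
            ≡⟨ cong (ℚ._+ h) (trans (ℚₚ.*-assoc σ (ιₙ (Q r)) Q⁻¹) (trans (cong (σ ℚ.*_) (trans (ℚₚ.*-comm (ιₙ (Q r)) Q⁻¹) (inverse (Q r) {{Q≢0 r}}))) (ℚₚ.*-identityʳ σ))) ⟩
          σ ℚ.+ h
            <⟨ p<p+q (½-pos (0<s r)) ⟩
          σ ℚ.+ h ℚ.+ h
            ≡⟨ trans (ℚₚ.+-assoc σ h h) (cong (σ ℚ.+_) (½+½ σ)) ⟩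
          σ ℚ.+ σ
            ≡⟨ solve 1 (λ s → s :+ s := s :+ s :+ (s :+ s) :- (s :+ s)) refl σ ⟩
          σ ℚ.+ σ ℚ.+ (σ ℚ.+ σ) ℚ.- (σ ℚ.+ σ)
            ≤⟨ ℚₚ.+-mono-≤ (apart r p′ q q≤Q α≉ n) (ℚₚ.neg-antimono-≤ (ℚₚ.≤-trans close (ℚₚ.+-monoʳ-≤ σ h≤σ))) ⟩
          D ℚ.- dist α ξ n
            ≤⟨ ℚₚ.+-monoˡ-≤ (ℚ.- dist α ξ n) (dist-triangle α ξ (p′ /ᵥ q) n) ⟩
          dist α ξ n ℚ.+ dist ξ (p′ /ᵥ q) n ℚ.- dist α ξ n
            ≡⟨ solve 2 (λ a b → a :+ b :- a := b) refl (dist α ξ n) (dist ξ (p′ /ᵥ q) n) ⟩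
          dist ξ (p′ /ᵥ q) n ∎
          where
          D : ℚ
          D = dist α (p′ /ᵥ q) n
          h≤σ : h ℚ.≤ σ
          h≤σ = subst (h ℚ.≤_) (½+½ σ) (p≤p+q (ℚₚ.<⇒≤ (½-pos (0<s r))))

    -- If ξ = p′/q, use the approximation p/b belonging to N = q, so that q ≤ Q. From ξ ≠ p/b these
    -- fractions are distinct and at least 4s apart, but `ξ` being within `s` of p/b allows only 2s,
    -- slack included.
    irrational : ∀ {ξ} → (∀ N → NearRational N ξ) → Irrational ξ
    irrational {ξ} near (p′ , q , q≢0 , ξ≈) = ℚₚ.<-irrefl refl (ℚₚ.<-≤-trans small (apart r p′ q {{q≢0}} (N≤Q r) α≉ N))
      where
      open NearRational
      r : NearRational q ξ
      r = near q
      σ : ℚ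
      σ = s r
      α γ : ℝ^ d
      α = (p r /ᵥ b r) {{b≢0 r}}
      γ = (p′ /ᵥ q) {{q≢0}}
      α≉ : ¬ α ≈ᵥ γ
      α≉ α≈ = ξ≉p/b r (≈-trans {d} {ξ} {γ} {α} ξ≈ (≈-sym {d} {α} {γ} α≈))
      close : Eventually λ n → dist α γ n ℚ.≤ σ ℚ.+ σ
      close = distance≲ (~-respʳ ξ≈ (~-sym (ξ~p/b r))) σ (0<s r)
      N : ℕ
      N = proj₁ close
      small : dist α γ N ℚ.< σ ℚ.+ σ ℚ.+ (σ ℚ.+ σ)
      small = ℚₚ.≤-<-trans (proj₂ close N ℕₚ.≤-refl)
        (p<p+q (ℚₚ.<-≤-trans (0<s r) (p≤p+q (ℚₚ.<⇒≤ (0<s r)))))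

    -- Choose a rational point p/b of C in the half ball, then `Q` with ∣Φ(Q)∣ < 1/(4b). A ball
    -- around p/b of radius at most s = 1/(4bQ) satisfies the bounds, and `avoid-dense` passes to a
    -- smaller one missing p/b itself.
    nearRational-dense : Perfect → (∀ B → ∃[ β ] β ∈ C × Rational β × β ∈ᵇ B) →
                         ∀ N → ContainsDenseOpen (NearRational N)
    nearRational-dense perfect rationals-dense N B =
      let β , β∈C , (p , b , b≢0 , β≈p/b) , β∈ = rationals-dense (half B)
      in around p b {{b≢0}} (≈-closed {β} {_} β≈p/b β∈C) (~-respˡ β≈p/b β∈)
      where
      around : ∀ (p : Vector ℤ d) b .{{_ : NonZero b}} → p /ᵥ b ∈ C → p /ᵥ b ∈ᵇ half B →
               Σ[ B′ ∈ Ball ] B′ ⊆ᵇ B × (∀ {z} → z ∈ᵇ B′ → NearRational N z)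
      around p b@(suc _) α∈C α∈ =
        let b₁ , center≡α , b₁⊆B = recenter B α∈C α∈
            b₂ , b₂⊆b₁ , b₂⊆s      = shrink b₁ s 0<s
            b₃ , b₃⊆b₂ , b₃≉α      = avoid-dense perfect (p /ᵥ b) b₂
        in b₃ , (λ z∈ → b₁⊆B (b₂⊆b₁ (b₃⊆b₂ z∈))) , λ {z} z∈ → record
             { p = p ; b = b ; Q = Q ; s = s
             ; N≤Q = ℕₚ.m≤n⇒m≤1+n (ℕₚ.m≤n+m N M)
             ; p/b∈C = α∈C ; 0<s = 0<s ; 4sbQ = 4sbQ
             ; Φ≤sQ = map∞ (λ n small → subst (seq (Φ Q) n ℚ.≤_) u≡sQ
                 (ℚₚ.≤-trans (ℚₚ.p≤p⊔q (seq (Φ Q) n) _) (ℚₚ.<⇒≤ (ℚₚ.≤-<-trans (p≤p+q (ℚₚ.<⇒≤ (proj₁ (proj₂ Φ<u)))) small))))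
                 (proj₂ (proj₂ Φ<u))
             ; ξ~p/b = subst (λ y → z ~[ s ] y) center≡α (b₂⊆s (b₃⊆b₂ z∈))
             ; ξ≉p/b = b₃≉α z∈
             }
        where
        u s v : ℚ
        -- 1/(4b), which is sQ whatever `Q` is; so `Q` can be chosen after it.
        u = ½ ℚ.* (½ ℚ.* (ℤ.+ 1 ℚ./ b))
        0<u : 0ℚ ℚ.< u
        0<u = ½-pos (½-pos (0<1/ b))
        M Q : ℕ
        M = proj₁ (Φ⟶0 (fromℚ u) (0<fromℚ 0<u))
        -- Beyond `N` and the threshold `M` for `Φ`, and positive by the successor.
        Q = suc (M ℕ.+ N)
        v = (ℤ.+ 1 ℚ./ b) ℚ.* (ℤ.+ 1 ℚ./ Q)
        s = ½ ℚ.* (½ ℚ.* v)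
        0<s : 0ℚ ℚ.< s
        0<s = ½-pos (½-pos (*-pos (0<1/ b) (0<1/ Q)))
        Φ<u : ∣ Φ Q ∣ < fromℚ u
        Φ<u = proj₂ (Φ⟶0 (fromℚ u) (0<fromℚ 0<u)) Q (ℕₚ.m≤n⇒m≤1+n (ℕₚ.m≤m+n M N))
        open ≡-Reasoning
        open +-*-Solver
        4sbQ : (s ℚ.+ s ℚ.+ (s ℚ.+ s)) ℚ.* (ιₙ b ℚ.* ιₙ Q) ≡ 1ℚ
        4sbQ = begin
          (s ℚ.+ s ℚ.+ (s ℚ.+ s)) ℚ.* (ιₙ b ℚ.* ιₙ Q)
            ≡⟨ cong (ℚ._* (ιₙ b ℚ.* ιₙ Q)) (trans (cong₂ ℚ._+_ (½+½ (½ ℚ.* v)) (½+½ (½ ℚ.* v))) (½+½ v)) ⟩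
          v ℚ.* (ιₙ b ℚ.* ιₙ Q)
            ≡⟨ solve 4 (λ x y z w → (x :* y) :* (z :* w) := (x :* z) :* (y :* w)) refl (ℤ.+ 1 ℚ./ b) (ℤ.+ 1 ℚ./ Q) (ιₙ b) (ιₙ Q) ⟩
          ((ℤ.+ 1 ℚ./ b) ℚ.* ιₙ b) ℚ.* ((ℤ.+ 1 ℚ./ Q) ℚ.* ιₙ Q)
            ≡⟨ cong₂ ℚ._*_ (inverse b) (inverse Q) ⟩
          1ℚ ∎
        u≡sQ : u ≡ s ℚ.* ιₙ Q
        u≡sQ = begin
          u
            ≡⟨ ℚₚ.*-identityʳ u ⟨
          u ℚ.* 1ℚ
            ≡⟨ cong (u ℚ.*_) (inverse Q) ⟨
          u ℚ.* ((ℤ.+ 1 ℚ./ Q) ℚ.* ιₙ Q)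
            ≡⟨ solve 4 (λ h x y z → h :* (h :* x) :* (y :* z) := h :* (h :* (x :* y)) :* z) refl ½ (ℤ.+ 1 ℚ./ b) (ℤ.+ 1 ℚ./ Q) (ιₙ Q) ⟩
          s ℚ.* ιₙ Q ∎

theorem3p2 : ExcludedMiddle 0ℓ →
    ∀ {d : ℕ} (F : IFS d) (C : Pred (ℝ^ d) 0ℓ) →
    Attractor F C →
    NonDegenerate C →
    RationalPreserving F →
    RationalFixedPoint F →
    OneToOne F ⊎ CountablyManyAddresses F C →
    (Φ : ℕ → ℝ) →
    (∀ Q .{{_ : NonZero Q}} → 0ℝ < Φ Q) →
    Φ ⟶0 →
    let S = λ ξ → ξ ∈ C × Irrational ξ × PoorlyApproximable C Φ ξ
    in Uncountable _≈ᵥ_ S × S DenseIn C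
theorem3p2 em {d} F C attractor nondegenerate preserves fixed hypothesis Φ _ Φ⟶0 =
  uncountable , proj₁ , dense
  where
  open Classical em
  open Attracting F C attractor
  open Approximation C compact ≈-closed Φ Φ⟶0

  S : Pred (ℝ^ d) 0ℓ
  S ξ = ξ ∈ C × Irrational ξ × PoorlyApproximable C Φ ξ

  perfect : Perfect
  perfect = [ one-to-one⇒perfect nondegenerate , countable-addresses⇒perfect nondegenerate ]′ hypothesis

  -- A single use of Baire's theorem serves both conclusions: `e` is a supposed enumeration for
  -- uncountability, and the prescribed ball gives density.
  avoiding : ∀ (e : ℕ → ℝ^ d) b → ∃[ ξ ] ξ ∈ S × ξ ∈ᵇ b × (∀ n → ¬ ξ ≈ᵥ e n)
  avoiding e b =
    let ξ , ξ∈C , ξ∈b , good = baire (λ n z → NearRational n z × ¬ z ≈ᵥ e n)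
          (λ n → nearRational-dense perfect (rationals-dense preserves fixed) n
                   ∩-dense avoid-dense perfect (e n)) b
    in ξ , (ξ∈C , irrational (proj₁ ∘ good) , poorlyApproximable (proj₁ ∘ good)) , ξ∈b , proj₂ ∘ good

  uncountable : Uncountable _≈ᵥ_ S
  uncountable (e , covers) =
    let ξ , ξ∈S , _ , ξ≉e = avoiding e (ball c₀ c₀∈C 1ℚ (ℚₚ.positive⁻¹ 1ℚ))
        n , eₙ≈ξ = covers ξ ξ∈S
    in ξ≉e n (≈-sym {d} {e n} {ξ} eₙ≈ξ)

  dense : ∀ x → x ∈ C → ∀ ε → 0ℝ < ε → Σ[ y ∈ ℝ^ d ] y ∈ S × ‖ y -ᵥ x ‖ < ε
  dense x x∈C ε 0<ε =
    let r , 0<r , below = below-positive {ε} 0<ε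
        -- Only the ball matters for density, so the sequence to avoid is filled with `x`.
        ξ , ξ∈S , ξ∈b , _ = avoiding (λ _ → x) (ball x x∈C r 0<r)
    in ξ , ξ∈S , below ‖ ξ -ᵥ x ‖ (distance≲ ξ∈b)
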